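{- For every constant $\epsilon\in[0,1)$ there is a constant $C_\epsilon$ such that for every Boolean function $f\colon\{0,1\}^n\to\{0,1\}$, \[ D(f)\le C_\epsilon\,\mathrm{ndeg}_\epsilon(f)^2\,\mathrm{ndeg}(\neg f)^2\quad\text{and}\quad D(f)\le C_\epsilon\,\mathrm{ndeg}(f)^2\,\mathrm{ndeg}_\epsilon(\neg f)^2 . \]
   Context: For $\epsilon\in[0,1)$, $\mathrm{ndeg}_\epsilon(f)$ is the minimum degree of a real polynomial $p$ such that for all $x\in\{0,1\}^n$: $|p(x)|\le\epsilon$ if $f(x)=0$ and $|p(x)|\ge1$ if $f(x)=1$. $\mathrm{ndeg}(f)=\mathrm{ndeg}_0(f)$, i.e. the minimum degree of a multilinear real polynomial $p$ with $p(x)\neq0$ iff $f(x)=1$. $\neg f=1-f$. $D(f)$ is the minimum depth of a deterministic decision tree that queries bits of $x$ and outputs $f(x)$ exactly for every $x\in\{0,1\}^n$.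
   Formalization: The constant ε is a rational number in [0,1), and the polynomials in the definition of ndeg_ε and ndeg have rational instead of real coefficients (the minimum degrees agree, by rational solvability of rational linear systems). -}

module Defs where

open import Data.Bool using (Bool; true; false; if_then_else_)
open import Data.Nat using (ℕ; zero; suc; _≤_; _⊔_)
open import Data.Fin using (Fin; zero; suc)
open import Data.Vec using (Vec; []; _∷_)
open import Data.List using (List; []; _∷_; map; _++_)
open import Data.Product using (Σ; _×_; ∃)
open import Data.Rational using (ℚ; 0ℚ; 1ℚ; _*_; _+_; ∣_∣) renaming (_≤_ to _≤ℚ_)
open import Relation.Binary.PropositionalEquality using (_≡_)
open import Relation.Nullary using (¬_)

Input : ℕ → Set
Input n = Fin n → Bool

BoolFun : ℕ → Set
BoolFun n = Input n → Bool

negF : ∀ {n} → BoolFun n → BoolFun n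
negF f x = if f x then false else true

-- Monomials of a multilinear polynomial: a subset S ⊆ [n], as a Bool vector.
Mono : ℕ → Set
Mono n = Vec Bool n

size : ∀ {n} → Mono n → ℕ
size [] = 0
size (true ∷ S) = suc (size S)
size (false ∷ S) = size S

bitℚ : Bool → ℚ
bitℚ true = 1ℚ
bitℚ false = 0ℚ

monoVal : ∀ {n} → Mono n → Input n → ℚ
monoVal [] x = 1ℚ
monoVal (true ∷ S) x = bitℚ (x zero) * monoVal S (λ i → x (suc i))
monoVal (false ∷ S) x = monoVal S (λ i → x (suc i))

allMonos : (n : ℕ) → List (Mono n)
allMonos zero = [] ∷ []
allMonos (suc n) = map (false ∷_) (allMonos n) ++ map (true ∷_) (allMonos n)

-- multilinear polynomial with rational coefficients = coefficient function
Poly : ℕ → Set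
Poly n = Mono n → ℚ

sumℚ : List ℚ → ℚ
sumℚ [] = 0ℚ
sumℚ (q ∷ qs) = q + sumℚ qs

evalPoly : ∀ {n} → Poly n → Input n → ℚ
evalPoly {n} p x = sumℚ (map (λ S → p S * monoVal S x) (allMonos n))

DegLe : ∀ {n} → Poly n → ℕ → Set
DegLe p d = ∀ S → ¬ (p S ≡ 0ℚ) → size S ≤ d

NondetPoly : ∀ {n} → ℚ → BoolFun n → Poly n → Set
NondetPoly ε f p =
  ∀ x → (f x ≡ false → ∣ evalPoly p x ∣ ≤ℚ ε) × (f x ≡ true → 1ℚ ≤ℚ ∣ evalPoly p x ∣)

HasNdegLe : ∀ {n} → ℚ → BoolFun n → ℕ → Set
HasNdegLe ε f d = Σ (Poly _) λ p → NondetPoly ε f p × DegLe p d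

IsMin : (ℕ → Set) → ℕ → Set
IsMin P d = P d × (∀ k → P k → d ≤ k)

IsNdegε : ∀ {n} → ℚ → BoolFun n → ℕ → Set
IsNdegε ε f = IsMin (HasNdegLe ε f)

IsNdeg : ∀ {n} → BoolFun n → ℕ → Set
IsNdeg f = IsNdegε 0ℚ f

data DTree (n : ℕ) : Set where
  leaf : Bool → DTree n
  node : Fin n → DTree n → DTree n → DTree n

runTree : ∀ {n} → DTree n → Input n → Bool
runTree (leaf b) x = b
runTree (node i t₀ t₁) x = if x i then runTree t₁ x else runTree t₀ x

depth : ∀ {n} → DTree n → ℕ
depth (leaf _) = 0
depth (node _ t₀ t₁) = suc (depth t₀ ⊔ depth t₁)

Computes : ∀ {n} → DTree n → BoolFun n → Set
Computes t f = ∀ x → runTree t x ≡ f x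

HasDLe : ∀ {n} → BoolFun n → ℕ → Set
HasDLe f d = Σ (DTree _) λ t → Computes t f × depth t ≤ d

IsD : ∀ {n} → BoolFun n → ℕ → Set
IsD f = IsMin (HasDLe f)

{-# OPTIONS --safe #-}

-- Let p be the ε-polynomial of f and q the exact polynomial of ¬f, of degree b.  If f is not
-- constantly 0, let x maximise |p|, so that |p x| ≥ 1.  Every monomial M of q of maximal degree
-- contains a block B with q ≠ 0, hence |p| ≤ ε, at x with B flipped.  For k disjoint such monomials,
-- flip each block independently with probability t: the expectation of p is a polynomial in t of
-- degree at most deg p, bounded by |p x| on [0,1], which drops by a constant fraction between t = 0 and
-- t = 1/(2k).  A Markov-type inequality then gives k = O((deg p)²).  Querying the variables of a
-- maximal disjoint family of such monomials lowers the degree of q, so b rounds suffice.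

module Submission where

open import Defs
open import Algebra.Bundles using (CommutativeRing)
import Algebra.Properties.Semiring.Mult as SemiringMult
open import Data.Bool.Base using (Bool; true; false; _∧_; _xor_; not; if_then_else_)
open import Data.Bool.Properties using (xor-same) renaming (_≟_ to _≟ᵇ_)
open import Data.Fin.Base using (Fin; zero; suc)
open import Data.Fin.Properties using (any?)
import Data.Integer.Base as ℤ
import Data.Integer.Properties as ℤₚ
open import Data.List.Base using (List; []; _∷_; map; length; _++_; concatMap)
open import Data.List.Membership.Propositional using (_∈_; lose)
open import Data.List.Membership.Propositional.Properties using (∈-map⁺; ∈-++⁺ˡ; ∈-++⁺ʳ)
open import Data.List.Properties using (map-++; map-∘; length-map; length-++)
open import Data.List.Relation.Binary.Pointwise using (Pointwise; []; _∷_; Pointwise-length)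
open import Data.List.Relation.Unary.All as All using (All; []; _∷_)
open import Data.List.Relation.Unary.All.Properties using (¬Any⇒All¬)
open import Data.List.Relation.Unary.AllPairs using (AllPairs; []; _∷_)
open import Data.List.Relation.Unary.Any as Any using (Any; here; there)
open import Data.List.Relation.Unary.Any.Properties using () renaming (++⁺ʳ to Any-++ʳ)
open import Data.Nat.Base as ℕ using (ℕ; zero; suc)
import Data.Nat.Properties as ℕₚ
open import Data.Nat.Tactic.RingSolver using () renaming (solve-∀ to solve-∀ⁿ)
open import Data.Product using (Σ; _×_; _,_; ∃; proj₁; proj₂)
import Data.Rational.Unnormalised.Base as ℚᵘ
import Data.Rational.Unnormalised.Properties as ℚᵘₚ
open import Data.Sum.Base using (_⊎_; inj₁; inj₂)
open import Data.Vec.Base using ([]; _∷_; lookup; zipWith)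
open import Data.Vec.Functional as VF using (updateAt)
open import Data.Vec.Functional.Properties using (updateAt-id-local)
open import Data.Vec.Properties using (lookup-zipWith)
open import Function.Base using (const; _∘_)
open import Relation.Binary.PropositionalEquality
  using (_≡_; _≢_; _≗_; refl; sym; trans; cong; cong₂; subst; subst₂; module ≡-Reasoning)
open import Relation.Nullary using (¬_; Dec; yes; no; contradiction; does)
open import Relation.Nullary.Decidable using (_×-dec_; ¬?; dec-true; dec-false; dec⇒maybe)
open import Tactic.RingSolver using (solve-∀)
open import Tactic.RingSolver.Core.AlmostCommutativeRing using (AlmostCommutativeRing; fromCommutativeRing)

-- `p` is at most `ε` in absolute value where `f` vanishes but may be arbitrarily large where `f` is
-- 1, so a Markov-type bound at an arbitrary point says nothing. At a maximiser of `|p|` the value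
-- there bounds `|p|` on the whole cube, and a flip landing where `|p| ≤ ε` loses at least the
-- fraction `1 - ε` of it; only this ratio enters. Restricting variables moves the maximum, so a
-- maximiser is taken anew in every round, while the degree bound on `p` persists. All arithmetic is
-- rational, so neither derivatives nor Chebyshev polynomials appear: the Markov-type inequality
-- comes from the values at `γ` and at the squares `0, 1, 4, ..., d²`, through a finite-difference
-- identity. The constant has to satisfy `C * (1 - ε) > 64`. A round at degree `e + 1` makes at most
-- `C a² (e + 1)` queries, and the sum over degrees up to `b` stays below `C a² b²`.

private variable
  n : ℕ

-- Ordered-field arithmetic in the rationals.

module Rationals where
  open import Data.Rational hiding (_≟_)
  open import Data.Rational.Properties

  module ℚMult = SemiringMult (CommutativeRing.semiring +-*-commutativeRing)

  ℚ-ring : AlmostCommutativeRing _ _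
  ℚ-ring = fromCommutativeRing +-*-commutativeRing λ x → dec⇒maybe (0ℚ ≟ x)

  -- Iterated addition makes `ι (suc n)` reduce to `1ℚ + ι n`, so identities about successors go
  -- straight to the ring solver.
  ι : ℕ → ℚ
  ι n = n ℚMult.× 1ℚ

  2ℚ : ℚ
  2ℚ = 1ℚ + 1ℚ

  4ℚ : ℚ
  4ℚ = 2ℚ * 2ℚ

  8ℚ : ℚ
  8ℚ = 2ℚ * 4ℚ

  16ℚ : ℚ
  16ℚ = 2ℚ * 8ℚ

  0≤+ : ∀ {x y} → 0ℚ ≤ x → 0ℚ ≤ y → 0ℚ ≤ x + y
  0≤+ = +-mono-≤

  0≤* : ∀ {x y} → 0ℚ ≤ x → 0ℚ ≤ y → 0ℚ ≤ x * y
  0≤* {x} {y} p q = nonNegative⁻¹ (x * y) {{nonNeg*nonNeg⇒nonNeg x {{nonNegative p}} y {{nonNegative q}}}}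

  0≤1 : 0ℚ ≤ 1ℚ
  0≤1 = nonNegative⁻¹ 1ℚ

  ≤⇒0≤- : ∀ {x y} → x ≤ y → 0ℚ ≤ y - x
  ≤⇒0≤- {x} {y} p = subst (_≤ y - x) (+-inverseʳ x) (+-monoˡ-≤ (- x) p)

  ≤-by : ∀ {x y} z → 0ℚ ≤ z → y ≡ x + z → x ≤ y
  ≤-by {x} {y} z p e = subst₂ _≤_ (+-identityʳ x) (sym e) (+-monoʳ-≤ x p)

  *-monoˡ : ∀ {x y} z → 0ℚ ≤ z → x ≤ y → z * x ≤ z * y
  *-monoˡ z p = *-monoˡ-≤-nonNeg z {{nonNegative p}}

  *-monoʳ : ∀ {x y} z → 0ℚ ≤ z → x ≤ y → x * z ≤ y * z
  *-monoʳ z p = *-monoʳ-≤-nonNeg z {{nonNegative p}}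

  *-cancelˡ-pos : ∀ {x y} z → 0ℚ < z → z * x ≡ z * y → x ≡ y
  *-cancelˡ-pos z p e = ≤-antisym
    (*-cancelˡ-≤-pos z {{positive p}} (≤-reflexive e))
    (*-cancelˡ-≤-pos z {{positive p}} (≤-reflexive (sym e)))

  0≤ι : ∀ n → 0ℚ ≤ ι n
  0≤ι zero = ≤-refl
  0≤ι (suc n) = 0≤+ 0≤1 (0≤ι n)

  0<1+ : ∀ {x} → 0ℚ ≤ x → 0ℚ < 1ℚ + x
  0<1+ p = +-mono-<-≤ (positive⁻¹ 1ℚ) p

  0<ι : ∀ n → 0ℚ < ι (suc n)
  0<ι n = 0<1+ (0≤ι n)

  ι-+ : ∀ m n → ι (m ℕ.+ n) ≡ ι m + ι n
  ι-+ = ℚMult.×-homo-+ 1ℚ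

  ι-* : ∀ m n → ι (m ℕ.* n) ≡ ι m * ι n
  ι-* = ℚMult.×1-homo-*

  ι-mono : ∀ {m n} → m ℕ.≤ n → ι m ≤ ι n
  ι-mono {n = n} ℕ.z≤n = 0≤ι n
  ι-mono (ℕ.s≤s p) = +-monoʳ-≤ 1ℚ (ι-mono p)

  ι-pos : ∀ n → Positive (ι (suc n))
  ι-pos n = positive (0<ι n)

  -- inv n = 1/(n+1).
  inv : ℕ → ℚ
  inv n = (1/ ι (suc n)) {{pos⇒nonZero (ι (suc n)) {{ι-pos n}}}}

  ι*inv : ∀ n → ι (suc n) * inv n ≡ 1ℚ
  ι*inv n = *-inverseʳ (ι (suc n)) {{pos⇒nonZero (ι (suc n)) {{ι-pos n}}}}

  0≤inv : ∀ n → 0ℚ ≤ inv n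
  0≤inv n = <⇒≤ (positive⁻¹ (inv n) {{1/pos⇒pos (ι (suc n)) {{ι-pos n}}}})

  ∣∣≤+ : ∀ {x y a b} → ∣ x ∣ ≤ a → ∣ y ∣ ≤ b → ∣ x + y ∣ ≤ a + b
  ∣∣≤+ {x} {y} p q = ≤-trans (∣p+q∣≤∣p∣+∣q∣ x y) (+-mono-≤ p q)

  ∣∣≤* : ∀ {x y a b} → 0ℚ ≤ a → ∣ x ∣ ≤ a → ∣ y ∣ ≤ b → ∣ x * y ∣ ≤ a * b
  ∣∣≤* {x} {y} {a} 0≤a p q = subst (_≤ _) (sym (∣p*q∣≡∣p∣*∣q∣ x y))
    (≤-trans (*-monoʳ ∣ y ∣ (0≤∣p∣ y) p) (*-monoˡ a 0≤a q))

-- A Markov-type inequality from values at squares.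

module MarkovInequality where
  open import Data.Rational hiding (_≟_)
  open import Data.Rational.Properties
  open Rationals

  -- Degree ≤ d, expressed by division with remainder by t - a at every point a.
  PolyDeg : ℕ → (ℚ → ℚ) → Set
  PolyDeg zero g = ∀ s t → g s ≡ g t
  PolyDeg (suc d) g = ∀ a → Σ (ℚ → ℚ) λ h → PolyDeg d h × (∀ t → g t ≡ g a + (t - a) * h t)

  poly-const : ∀ d c → PolyDeg d (λ _ → c)
  poly-const zero c s t = refl
  poly-const (suc d) c a = (λ _ → 0ℚ) , poly-const d 0ℚ , λ t → lem c t a
    where
    lem : ∀ (c t a : ℚ) → c ≡ c + (t - a) * 0ℚ
    lem = solve-∀ ℚ-ring

  poly-cong : ∀ d {g g′} → (∀ t → g t ≡ g′ t) → PolyDeg d g → PolyDeg d g′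
  poly-cong zero e p s t = trans (sym (e s)) (trans (p s t) (e t))
  poly-cong (suc d) e p a with p a
  ... | h , ph , eh = h , ph , λ t → trans (sym (e t)) (trans (eh t) (cong (_+ (t - a) * h t) (e a)))

  poly-+ : ∀ d {g g′} → PolyDeg d g → PolyDeg d g′ → PolyDeg d (λ t → g t + g′ t)
  poly-+ zero p q s t = cong₂ _+_ (p s t) (q s t)
  poly-+ (suc d) {g} {g′} p q a with p a | q a
  ... | h , ph , eh | h′ , ph′ , eh′ = _ , poly-+ d ph ph′ ,
    λ t → trans (cong₂ _+_ (eh t) (eh′ t)) (lem (g a) (g′ a) (t - a) (h t) (h′ t))
    where
    lem : ∀ (x y u v w : ℚ) → (x + u * v) + (y + u * w) ≡ (x + y) + u * (v + w)
    lem = solve-∀ ℚ-ring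

  poly-affine : ∀ d {g} α β → PolyDeg d g → PolyDeg (suc d) (λ t → (α + β * t) * g t)
  poly-affine zero {g} α β p a = _ , poly-const 0 (β * g a) ,
    λ t → trans (cong ((α + β * t) *_) (p t a)) (lem α β t a (g a))
    where
    lem : ∀ (α β t a y : ℚ) → (α + β * t) * y ≡ (α + β * a) * y + (t - a) * (β * y)
    lem = solve-∀ ℚ-ring
  poly-affine (suc d) {g} α β p a with p a
  ... | h , ph , eh = _ , poly-+ (suc d) (poly-const (suc d) (β * g a)) (poly-affine d α β ph) ,
    λ t → trans (cong ((α + β * t) *_) (eh t)) (lem α β t a (g a) (h t))
    where
    lem : ∀ (α β t a y z : ℚ) → (α + β * t) * (y + (t - a) * z)
          ≡ (α + β * a) * y + (t - a) * (β * y + (α + β * t) * z)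
    lem = solve-∀ ℚ-ring

  poly-suc : ∀ d {g} → PolyDeg d g → PolyDeg (suc d) g
  poly-suc d {g} p = poly-cong (suc d) (λ t → lem t (g t)) (poly-affine d 1ℚ 0ℚ p)
    where
    lem : ∀ (t y : ℚ) → (1ℚ + 0ℚ * t) * y ≡ y
    lem = solve-∀ ℚ-ring

  poly-mono : ∀ {d e} {g} → d ℕ.≤′ e → PolyDeg d g → PolyDeg e g
  poly-mono ℕ.≤′-refl p = p
  poly-mono (ℕ.≤′-step le) p = poly-suc _ (poly-mono le p)

  poly-* : ∀ d {g} κ → PolyDeg d g → PolyDeg d (λ t → κ * g t)
  poly-* zero κ p s t = cong (κ *_) (p s t)
  poly-* (suc d) {g} κ p a with p a
  ... | h , ph , eh = _ , poly-* d κ ph , λ t → trans (cong (κ *_) (eh t)) (lem κ (g a) (t - a) (h t))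
    where
    lem : ∀ (k x u v : ℚ) → k * (x + u * v) ≡ k * x + u * (k * v)
    lem = solve-∀ ℚ-ring

  poly-scale : ∀ d {g} κ → PolyDeg d g → PolyDeg d (λ t → g (κ * t))
  poly-scale zero κ p s t = p (κ * s) (κ * t)
  poly-scale (suc d) {g} κ p a with p (κ * a)
  ... | h , ph , eh = _ , poly-* d κ (poly-scale d κ ph) ,
    λ t → trans (eh (κ * t)) (lem κ t a (g (κ * a)) (h (κ * t)))
    where
    lem : ∀ (k t a y z : ℚ) → y + (k * t - k * a) * z ≡ y + (t - a) * (k * z)
    lem = solve-∀ ℚ-ring

  -- u 1 + … + u m; u 0 is not included.
  S : (ℕ → ℚ) → ℕ → ℚ
  S u zero = 0ℚ
  S u (suc m) = S u m + u (suc m)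

  S-scale : ∀ {u w} c → (∀ j → u j ≡ c * w j) → ∀ m → S u m ≡ c * S w m
  S-scale c e zero = sym (*-zeroʳ c)
  S-scale {w = w} c e (suc m) = trans (cong₂ _+_ (S-scale c e m) (e (suc m))) (sym (*-distribˡ-+ c (S w m) (w (suc m))))

  S-+ : ∀ {u v w} → (∀ j → u j ≡ v j + w j) → ∀ m → S u m ≡ S v m + S w m
  S-+ e zero = refl
  S-+ {v = v} {w} e (suc m) = trans (cong₂ _+_ (S-+ e m) (e (suc m))) (lem (S v m) (S w m) (v (suc m)) (w (suc m)))
    where
    lem : ∀ (a b c d : ℚ) → (a + b) + (c + d) ≡ (a + c) + (b + d)
    lem = solve-∀ ℚ-ring

  -- ω d j = 2 (-1)^j C(2d, d+j) / C(2d, d).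
  ω : ℕ → ℕ → ℚ
  ω d zero = 2ℚ
  ω d (suc m) = - (ω d m * ((ι d - ι m) * inv (d ℕ.+ m)))

  ω-rec : ∀ d m → (1ℚ + (ι d + ι m)) * ω d (suc m) ≡ - (ω d m * (ι d - ι m))
  ω-rec d m = begin
    (1ℚ + (ι d + ι m)) * ω d (suc m) ≡⟨ lem (1ℚ + (ι d + ι m)) (ω d m) (ι d - ι m) (inv (d ℕ.+ m)) ⟩
    - (ω d m * (ι d - ι m)) * ((1ℚ + (ι d + ι m)) * inv (d ℕ.+ m))
      ≡⟨ cong (λ z → - (ω d m * (ι d - ι m)) * ((1ℚ + z) * inv (d ℕ.+ m))) (sym (ι-+ d m)) ⟩
    - (ω d m * (ι d - ι m)) * (ι (suc (d ℕ.+ m)) * inv (d ℕ.+ m))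
      ≡⟨ cong (- (ω d m * (ι d - ι m)) *_) (ι*inv (d ℕ.+ m)) ⟩
    - (ω d m * (ι d - ι m)) * 1ℚ ≡⟨ *-identityʳ _ ⟩
    - (ω d m * (ι d - ι m)) ∎
    where
    open ≡-Reasoning
    lem : ∀ (k w u r : ℚ) → k * (- (w * (u * r))) ≡ - (w * u) * (k * r)
    lem = solve-∀ ℚ-ring

  -- Relates the weights of two consecutive orders: the factor `(d+1)² - j²` is what the root at the
  -- new node contributes in `L-root`. Both sides satisfy the recursion `ω-rec`, hence the induction
  -- on `j` after multiplying by the positive denominator `1 + d + j`.
  ω-suc : ∀ d j → ω (suc d) j * (ι (suc d) * ι (suc d) - ι j * ι j) ≡ (ι (suc d) * ι (suc d)) * ω d j
  ω-suc d zero = lem (ι d)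
    where
    lem : ∀ (D : ℚ) → 2ℚ * ((1ℚ + D) * (1ℚ + D) - 0ℚ * 0ℚ) ≡ (1ℚ + D) * (1ℚ + D) * 2ℚ
    lem = solve-∀ ℚ-ring
  ω-suc d (suc j) = *-cancelˡ-pos (1ℚ + (ι d + ι j)) (0<1+ (0≤+ (0≤ι d) (0≤ι j))) (begin
    (1ℚ + (D + J)) * (w′⁺ * ((1ℚ + D) * (1ℚ + D) - (1ℚ + J) * (1ℚ + J))) ≡⟨ lem₁ D J w′⁺ ⟩
    (1ℚ + (D + J)) * (D - J) * ((1ℚ + ((1ℚ + D) + J)) * w′⁺) ≡⟨ cong ((1ℚ + (D + J)) * (D - J) *_) (ω-rec (suc d) j) ⟩
    (1ℚ + (D + J)) * (D - J) * (- (w′ * ((1ℚ + D) - J))) ≡⟨ lem₂ D J w′ ⟩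
    - ((w′ * ((1ℚ + D) * (1ℚ + D) - J * J)) * (D - J)) ≡⟨ cong (λ z → - (z * (D - J))) (ω-suc d j) ⟩
    - ((1ℚ + D) * (1ℚ + D) * w * (D - J)) ≡⟨ lem₃ ((1ℚ + D) * (1ℚ + D)) w (D - J) ⟩
    (1ℚ + D) * (1ℚ + D) * (- (w * (D - J))) ≡⟨ cong ((1ℚ + D) * (1ℚ + D) *_) (sym (ω-rec d j)) ⟩
    (1ℚ + D) * (1ℚ + D) * ((1ℚ + (D + J)) * w⁺) ≡⟨ lem₄ ((1ℚ + D) * (1ℚ + D)) (1ℚ + (D + J)) w⁺ ⟩
    (1ℚ + (D + J)) * ((1ℚ + D) * (1ℚ + D) * w⁺) ∎)
    where
    open ≡-Reasoning
    D = ι d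
    J = ι j
    w = ω d j
    w⁺ = ω d (suc j)
    w′ = ω (suc d) j
    w′⁺ = ω (suc d) (suc j)
    lem₁ : ∀ (D J w : ℚ) → (1ℚ + (D + J)) * (w * ((1ℚ + D) * (1ℚ + D) - (1ℚ + J) * (1ℚ + J))) ≡
      (1ℚ + (D + J)) * (D - J) * ((1ℚ + ((1ℚ + D) + J)) * w)
    lem₁ = solve-∀ ℚ-ring
    lem₂ : ∀ (D J w : ℚ) → (1ℚ + (D + J)) * (D - J) * (- (w * ((1ℚ + D) - J))) ≡
      - ((w * ((1ℚ + D) * (1ℚ + D) - J * J)) * (D - J))
    lem₂ = solve-∀ ℚ-ring
    lem₃ : ∀ (k w u : ℚ) → - (k * w * u) ≡ k * (- (w * u))
    lem₃ = solve-∀ ℚ-ring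
    lem₄ : ∀ (k w u : ℚ) → k * (w * u) ≡ w * (k * u)
    lem₄ = solve-∀ ℚ-ring

  sq : ℕ → ℚ
  sq j = ι j * ι j

  -- Up to normalisation, the central difference of order 2d of j ↦ g(j²) at j = 0; it kills
  -- polynomials g of degree < d.
  L : ℕ → (ℚ → ℚ) → ℚ
  L d g = g 0ℚ + S (λ j → ω d j * g (sq j)) d

  L-+ : ∀ d {g} h k → (∀ t → g t ≡ h t + k t) → L d g ≡ L d h + L d k
  L-+ d h k e = trans
    (cong₂ _+_ (e 0ℚ) (S-+ (λ j → trans (cong (ω d j *_) (e (sq j))) (*-distribˡ-+ (ω d j) (h (sq j)) (k (sq j)))) d))
    (lem (h 0ℚ) (k 0ℚ) _ _)
    where
    lem : ∀ (a b c d : ℚ) → (a + b) + (c + d) ≡ (a + c) + (b + d)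
    lem = solve-∀ ℚ-ring

  -- Partial alternating sums along a row of Pascal's triangle are again single binomials up to
  -- sign. The closed form carries the factor `d - m`, so the complete sum vanishes.
  ω-partial-sum : ∀ d m → 2ℚ * ι d * (1ℚ + S (ω d) m) ≡ ω d m * (ι d - ι m)
  ω-partial-sum d zero = lem (ι d)
    where
    lem : ∀ (D : ℚ) → 2ℚ * D * (1ℚ + 0ℚ) ≡ 2ℚ * (D - 0ℚ)
    lem = solve-∀ ℚ-ring
  ω-partial-sum d (suc m) = begin
    2ℚ * D * (1ℚ + (S (ω d) m + w⁺)) ≡⟨ lem₁ D (S (ω d) m) w⁺ ⟩
    2ℚ * D * (1ℚ + S (ω d) m) + 2ℚ * D * w⁺ ≡⟨ cong (_+ 2ℚ * D * w⁺) (ω-partial-sum d m) ⟩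
    ω d m * (D - M) + 2ℚ * D * w⁺ ≡⟨ lem₂ (ω d m * (D - M)) _ ⟩
    - (- (ω d m * (D - M))) + 2ℚ * D * w⁺ ≡⟨ cong (λ z → - z + 2ℚ * D * w⁺) (sym (ω-rec d m)) ⟩
    - ((1ℚ + (D + M)) * w⁺) + 2ℚ * D * w⁺ ≡⟨ lem₃ D M w⁺ ⟩
    w⁺ * (D - (1ℚ + M)) ∎
    where
    open ≡-Reasoning
    D = ι d
    M = ι m
    w⁺ = ω d (suc m)
    lem₁ : ∀ (D s w : ℚ) → 2ℚ * D * (1ℚ + (s + w)) ≡ 2ℚ * D * (1ℚ + s) + 2ℚ * D * w
    lem₁ = solve-∀ ℚ-ring
    lem₂ : ∀ (x y : ℚ) → x + y ≡ - (- x) + y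
    lem₂ = solve-∀ ℚ-ring
    lem₃ : ∀ (D M w : ℚ) → - ((1ℚ + (D + M)) * w) + 2ℚ * D * w ≡ w * (D - (1ℚ + M))
    lem₃ = solve-∀ ℚ-ring

  ω-sum : ∀ d → 1ℚ + S (ω (suc d)) (suc d) ≡ 0ℚ
  ω-sum d = *-cancelˡ-pos (2ℚ * ι (suc d))
    (positive⁻¹ _ {{pos*pos⇒pos 2ℚ (ι (suc d)) {{positive (0<ι d)}}}})
    (trans (ω-partial-sum (suc d) (suc d)) (lem (ω (suc d) (suc d)) (ι (suc d))))
    where
    lem : ∀ (w x : ℚ) → w * (x - x) ≡ 2ℚ * x * 0ℚ
    lem = solve-∀ ℚ-ring

  L-const : ∀ d c → L (suc d) (λ _ → c) ≡ 0ℚ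
  L-const d c = begin
    c + S (λ j → ω (suc d) j * c) (suc d) ≡⟨ cong (c +_) (S-scale c (λ j → *-comm (ω (suc d) j) c) (suc d)) ⟩
    c + c * S (ω (suc d)) (suc d) ≡⟨ lem c _ ⟩
    c * (1ℚ + S (ω (suc d)) (suc d)) ≡⟨ cong (c *_) (ω-sum d) ⟩
    c * 0ℚ ≡⟨ *-zeroʳ c ⟩
    0ℚ ∎
    where
    open ≡-Reasoning
    lem : ∀ (c s : ℚ) → c + c * s ≡ c * (1ℚ + s)
    lem = solve-∀ ℚ-ring

  -- The root at the last node removes that node from the sum, and `ω-suc` turns the remaining
  -- weights into those of order `d`, with the common factor `- (d+1)²`.
  L-root : ∀ d h → L (suc d) (λ t → (t - sq (suc d)) * h t) ≡ - sq (suc d) * L d h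
  L-root d h = begin
    (0ℚ - a) * h 0ℚ + (S u d + u (suc d))
      ≡⟨ cong₂ (λ x y → (0ℚ - a) * h 0ℚ + (x + y)) (S-scale (- a) eq d) (lem₁ (ω (suc d) (suc d)) a (h a)) ⟩
    (0ℚ - a) * h 0ℚ + (- a * S (λ j → ω d j * h (sq j)) d + 0ℚ) ≡⟨ lem₂ a (h 0ℚ) _ ⟩
    - a * L d h ∎
    where
    open ≡-Reasoning
    a = sq (suc d)
    u : ℕ → ℚ
    u j = ω (suc d) j * ((sq j - a) * h (sq j))
    lem₁ : ∀ (w a x : ℚ) → w * ((a - a) * x) ≡ 0ℚ
    lem₁ = solve-∀ ℚ-ring
    lem₂ : ∀ (a x s : ℚ) → (0ℚ - a) * x + (- a * s + 0ℚ) ≡ - a * (x + s)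
    lem₂ = solve-∀ ℚ-ring
    lem₃ : ∀ (w a b x : ℚ) → w * ((b - a) * x) ≡ - (w * (a - b) * x)
    lem₃ = solve-∀ ℚ-ring
    lem₄ : ∀ (a w x : ℚ) → - (a * w * x) ≡ - a * (w * x)
    lem₄ = solve-∀ ℚ-ring
    eq : ∀ j → u j ≡ - a * (ω d j * h (sq j))
    eq j = trans (lem₃ (ω (suc d) j) a (sq j) (h (sq j)))
      (trans (cong (λ z → - (z * h (sq j))) (ω-suc d j)) (lem₄ a (ω d j) (h (sq j))))

  -- Division at the last node splits `g` into a constant, killed because the weights sum to zero,
  -- and a multiple of `t - a`, for which `L-root` lowers order and degree together.
  L-vanishes : ∀ d {g} → PolyDeg d g → L (suc d) g ≡ 0ℚ
  -- `g` is constant only pointwise; `L-+` with a zero summand transports this without function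
  -- extensionality.
  L-vanishes zero {g} p = trans (L-+ 1 (λ _ → g 0ℚ) (λ _ → 0ℚ) (λ t → trans (p t 0ℚ) (sym (+-identityʳ (g 0ℚ)))))
    (cong₂ _+_ (L-const 0 (g 0ℚ)) (L-const 0 0ℚ))
  L-vanishes (suc d) {g} p with p (sq (suc (suc d)))
  ... | h , ph , eh = begin
    L (suc (suc d)) g ≡⟨ L-+ (suc (suc d)) (λ _ → g a) (λ t → (t - a) * h t) eh ⟩
    L (suc (suc d)) (λ _ → g a) + L (suc (suc d)) (λ t → (t - a) * h t)
      ≡⟨ cong₂ _+_ (L-const (suc d) (g a)) (trans (L-root (suc d) h) (cong (- a *_) (L-vanishes d ph))) ⟩
    0ℚ + - a * 0ℚ ≡⟨ lem a ⟩
    0ℚ ∎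
    where
    open ≡-Reasoning
    a = sq (suc (suc d))
    lem : ∀ (a : ℚ) → 0ℚ + - a * 0ℚ ≡ 0ℚ
    lem = solve-∀ ℚ-ring

  -- Consecutive weights have the ratio `(d - m)/(d + m + 1)` in absolute value, which lies in
  -- [0,1], so the initial 2 dominates.
  ∣ω∣≤2 : ∀ d j → j ℕ.≤ d → ∣ ω d j ∣ ≤ 2ℚ
  ∣ω∣≤2 d zero _ = ≤-refl
  ∣ω∣≤2 d (suc m) m<d = subst (_≤ 2ℚ) (sym (∣-p∣≡∣p∣ (ω d m * r)))
    (∣∣≤* {ω d m} {r} {2ℚ} {1ℚ} (nonNegative⁻¹ 2ℚ) (∣ω∣≤2 d m m≤d) (subst (_≤ 1ℚ) (sym (0≤p⇒∣p∣≡p 0≤r)) r≤1))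
    where
    m≤d = ℕₚ.<⇒≤ m<d
    r = (ι d - ι m) * inv (d ℕ.+ m)
    0≤r : 0ℚ ≤ r
    0≤r = 0≤* (≤⇒0≤- (ι-mono m≤d)) (0≤inv (d ℕ.+ m))
    lem : ∀ (D M : ℚ) → 1ℚ + (D + M) ≡ (D - M) + (1ℚ + (M + M))
    lem = solve-∀ ℚ-ring
    r≤1 : r ≤ 1ℚ
    r≤1 = subst (r ≤_) (ι*inv (d ℕ.+ m)) (*-monoʳ {ι d - ι m} (inv (d ℕ.+ m)) (0≤inv (d ℕ.+ m))
      (≤-by (1ℚ + (ι m + ι m)) (0≤+ 0≤1 (0≤+ (0≤ι m) (0≤ι m)))
        (trans (cong (1ℚ +_) (ι-+ d m)) (lem (ι d) (ι m)))))

  inv-telescope : ∀ m → inv m * inv (suc m) ≡ inv m - inv (suc m)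
  inv-telescope m = begin
    r * r⁺ ≡⟨ lem₁ r r⁺ (ι (suc m)) ⟩
    r * ((1ℚ + ι (suc m)) * r⁺) - ι (suc m) * r * r⁺ ≡⟨ cong₂ (λ x y → r * x - y * r⁺) (ι*inv (suc m)) (ι*inv m) ⟩
    r * 1ℚ - 1ℚ * r⁺ ≡⟨ lem₂ r r⁺ ⟩
    r - r⁺ ∎
    where
    open ≡-Reasoning
    r = inv m
    r⁺ = inv (suc m)
    lem₁ : ∀ (x y k : ℚ) → x * y ≡ x * ((1ℚ + k) * y) - k * x * y
    lem₁ = solve-∀ ℚ-ring
    lem₂ : ∀ (x y : ℚ) → x * 1ℚ - 1ℚ * y ≡ x - y
    lem₂ = solve-∀ ℚ-ring

  -- The bounds `1/((m+1)(m+2))` telescope to `1 - 1/(d+1)`, so the sum is bounded independently of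
  -- `d`.
  ∣S∣≤ : ∀ u B → 0ℚ ≤ B → ∀ d → (∀ m → m ℕ.< d → ∣ u (suc m) ∣ ≤ B * (inv m * inv (suc m))) →
    ∣ S u d ∣ ≤ B
  ∣S∣≤ u B 0≤B d p = ≤-trans (go d ℕₚ.≤-refl) (≤-by (B * inv d) (0≤* 0≤B (0≤inv d)) (lem B (inv d)))
    where
    lem : ∀ (B r : ℚ) → B ≡ B * (1ℚ - r) + B * r
    lem = solve-∀ ℚ-ring
    lem₀ : ∀ (B : ℚ) → 0ℚ ≡ B * (1ℚ - 1ℚ)
    lem₀ = solve-∀ ℚ-ring
    lem₁ : ∀ (B r r⁺ : ℚ) → B * (1ℚ - r) + B * (r - r⁺) ≡ B * (1ℚ - r⁺)
    lem₁ = solve-∀ ℚ-ring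
    go : ∀ m → m ℕ.≤ d → ∣ S u m ∣ ≤ B * (1ℚ - inv m)
    go zero _ = ≤-reflexive (lem₀ B)
    go (suc m) m<d = subst (∣ S u m + u (suc m) ∣ ≤_)
      (trans (cong (λ z → B * (1ℚ - inv m) + B * z) (inv-telescope m)) (lem₁ B (inv m) (inv (suc m))))
      (∣∣≤+ {S u m} {u (suc m)} (go m (ℕₚ.<⇒≤ m<d)) (p m m<d))

  -- x is |h(j²)|, recovered from x (j² - γ) ≤ 2M with j = m + 1.
  quotient-bound : ∀ m {x γ M} → 0ℚ ≤ x → γ + γ ≤ 1ℚ → x * (sq (suc m) - γ) ≤ 2ℚ * M →
    x ≤ 8ℚ * M * (inv m * inv (suc m))
  quotient-bound m {x} {γ} {M} 0≤x γ≤ p = begin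
    x ≡⟨ trans (sym (*-identityʳ x)) (cong₂ (λ a b → x * (a * b)) (sym (ι*inv m)) (sym (ι*inv (suc m)))) ⟩
    x * ((J * r) * ((1ℚ + J) * r⁺)) ≡⟨ lem₁ x J r r⁺ ⟩
    x * (J * (1ℚ + J)) * (r * r⁺) ≤⟨ *-monoʳ (r * r⁺) (0≤* (0≤inv m) (0≤inv (suc m))) bound ⟩
    8ℚ * M * (r * r⁺) ∎
    where
    open ≤-Reasoning
    J = ι (suc m)
    r = inv m
    r⁺ = inv (suc m)
    lem₁ : ∀ (x J r r⁺ : ℚ) → x * ((J * r) * ((1ℚ + J) * r⁺)) ≡ x * (J * (1ℚ + J)) * (r * r⁺)
    lem₁ = solve-∀ ℚ-ring
    -- With `j = m + 1`, the difference `4(j² - γ) - j(j+1)` is `2(1 - 2γ) + 5m + 3m²`. It is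
    -- nonnegative because `γ ≤ 1/2`, and the 4 times the given 2 yields the 8.
    lem₂ : ∀ (x γ m : ℚ) → 4ℚ * (x * ((1ℚ + m) * (1ℚ + m) - γ)) ≡
      x * ((1ℚ + m) * (1ℚ + (1ℚ + m))) + x * (2ℚ * (1ℚ - (γ + γ)) + ((m * 2ℚ + m) + (m * 2ℚ + m * (m * 2ℚ + m))))
    lem₂ = solve-∀ ℚ-ring
    lem₃ : ∀ (M : ℚ) → 4ℚ * (2ℚ * M) ≡ 8ℚ * M
    lem₃ = solve-∀ ℚ-ring
    0≤2 : 0ℚ ≤ 2ℚ
    0≤2 = nonNegative⁻¹ 2ℚ
    0≤μ : 0ℚ ≤ ι m * 2ℚ + ι m
    0≤μ = 0≤+ (0≤* (0≤ι m) 0≤2) (0≤ι m)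
    bound : x * (J * (1ℚ + J)) ≤ 8ℚ * M
    bound = begin
      x * (J * (1ℚ + J)) ≤⟨ ≤-by _ (0≤* 0≤x (0≤+ (0≤* 0≤2 (≤⇒0≤- γ≤)) (0≤+ 0≤μ (0≤+ (0≤* (0≤ι m) 0≤2) (0≤* (0≤ι m) 0≤μ))))) (lem₂ x γ (ι m)) ⟩
      4ℚ * (x * (sq (suc m) - γ)) ≤⟨ *-monoˡ 4ℚ (nonNegative⁻¹ 4ℚ) p ⟩
      4ℚ * (2ℚ * M) ≡⟨ lem₃ M ⟩
      8ℚ * M ∎

  -- Dividing by `t - γ` turns the difference into `- γ * h 0ℚ` with `h` of degree one less.
  -- `L-vanishes` expresses `h 0ℚ` through the values of `h` at positive squares, and these are
  -- bounded through `g`. At square nodes the weights stay bounded and `1/j²` is summable; that the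
  -- nodes extend to `d²` is the quadratic loss in Markov's inequality.
  markov : ∀ d {g} → PolyDeg d g → ∀ {γ M} → 0ℚ ≤ γ → γ + γ ≤ 1ℚ → 0ℚ ≤ M →
    (∀ j → j ℕ.≤ d → ∣ g (sq j) ∣ ≤ M) → ∣ g γ ∣ ≤ M → ∣ g 0ℚ - g γ ∣ ≤ γ * (16ℚ * M)
  markov zero {g} p {γ} {M} 0≤γ γ≤ 0≤M _ _ = subst (_≤ γ * (16ℚ * M)) (sym e)
    (0≤* 0≤γ (0≤* (nonNegative⁻¹ 16ℚ) 0≤M))
    where
    e : ∣ g 0ℚ - g γ ∣ ≡ 0ℚ
    e = cong ∣_∣ (trans (cong (_- g γ) (p 0ℚ γ)) (+-inverseʳ (g γ)))
  markov (suc d) {g} p {γ} {M} 0≤γ γ≤ 0≤M node-bound γ-bound with p γ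
  ... | h , ph , eh = subst (_≤ γ * (16ℚ * M)) (sym e) (*-monoˡ γ 0≤γ ∣h0∣≤)
    where
    -- `T` equals `- h 0ℚ`, because `h 0ℚ + T` is `L (suc d) h`, which vanishes.
    T : ℚ
    T = S (λ j → ω (suc d) j * h (sq j)) (suc d)
    lem₁ : ∀ (y γ z T : ℚ) → (y + (0ℚ - γ) * z) - y ≡ γ * (T - (z + T))
    lem₁ = solve-∀ ℚ-ring
    lem₂ : ∀ (γ T : ℚ) → γ * (T - 0ℚ) ≡ γ * T
    lem₂ = solve-∀ ℚ-ring
    lem₃ : ∀ (y u x : ℚ) → x * u ≡ (y + u * x) - y
    lem₃ = solve-∀ ℚ-ring
    lem₄ : ∀ (M r : ℚ) → 2ℚ * (8ℚ * M * r) ≡ 16ℚ * M * r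
    lem₄ = solve-∀ ℚ-ring
    lem₅ : ∀ (M : ℚ) → M + M ≡ 2ℚ * M
    lem₅ = solve-∀ ℚ-ring
    lem₆ : ∀ (γ m : ℚ) → (1ℚ + m) * (1ℚ + m) - γ ≡ (1ℚ - (γ + γ)) + (γ + (m + m + m * m))
    lem₆ = solve-∀ ℚ-ring
    e : ∣ g 0ℚ - g γ ∣ ≡ γ * ∣ T ∣
    e = begin
      ∣ g 0ℚ - g γ ∣ ≡⟨ cong ∣_∣ (trans (cong (_- g γ) (eh 0ℚ)) (lem₁ (g γ) γ (h 0ℚ) T)) ⟩
      ∣ γ * (T - L (suc d) h) ∣ ≡⟨ cong (λ z → ∣ γ * (T - z) ∣) (L-vanishes d ph) ⟩
      ∣ γ * (T - 0ℚ) ∣ ≡⟨ cong ∣_∣ (lem₂ γ T) ⟩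
      ∣ γ * T ∣ ≡⟨ ∣p*q∣≡∣p∣*∣q∣ γ T ⟩
      ∣ γ ∣ * ∣ T ∣ ≡⟨ cong (_* ∣ T ∣) (0≤p⇒∣p∣≡p 0≤γ) ⟩
      γ * ∣ T ∣ ∎
      where open ≡-Reasoning
    quotient : ∀ m → m ℕ.< suc d → ∣ h (sq (suc m)) ∣ * (sq (suc m) - γ) ≤ 2ℚ * M
    quotient m m<d = begin
      ∣ x ∣ * u ≡⟨ cong (∣ x ∣ *_) (sym (0≤p⇒∣p∣≡p 0≤u)) ⟩
      ∣ x ∣ * ∣ u ∣ ≡⟨ sym (∣p*q∣≡∣p∣*∣q∣ x u) ⟩
      ∣ x * u ∣ ≡⟨ cong ∣_∣ (trans (lem₃ (g γ) u x) (cong (_- g γ) (sym (eh (sq (suc m)))))) ⟩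
      ∣ g (sq (suc m)) - g γ ∣ ≤⟨ ∣p-q∣≤∣p∣+∣q∣ (g (sq (suc m))) (g γ) ⟩
      ∣ g (sq (suc m)) ∣ + ∣ g γ ∣ ≤⟨ +-mono-≤ (node-bound (suc m) m<d) γ-bound ⟩
      M + M ≡⟨ lem₅ M ⟩
      2ℚ * M ∎
      where
      open ≤-Reasoning
      x = h (sq (suc m))
      u = sq (suc m) - γ
      0≤u : 0ℚ ≤ u
      0≤u = subst (0ℚ ≤_) (sym (lem₆ γ (ι m)))
        (0≤+ (≤⇒0≤- γ≤) (0≤+ 0≤γ (0≤+ (0≤+ (0≤ι m) (0≤ι m)) (0≤* (0≤ι m) (0≤ι m)))))
    ∣h0∣≤ : ∣ T ∣ ≤ 16ℚ * M
    ∣h0∣≤ = ∣S∣≤ _ (16ℚ * M) (0≤* (nonNegative⁻¹ 16ℚ) 0≤M) (suc d) λ m m<d →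
      subst (∣ ω (suc d) (suc m) * h (sq (suc m)) ∣ ≤_) (lem₄ M (inv m * inv (suc m)))
        (∣∣≤* {ω (suc d) (suc m)} {h (sq (suc m))} (nonNegative⁻¹ 2ℚ) (∣ω∣≤2 (suc d) (suc m) m<d)
          (quotient-bound m {M = M} (0≤∣p∣ (h (sq (suc m)))) γ≤ (quotient m m<d)))

-- Random block flips and the bound on the number of disjoint sensitive blocks.

module BlockFlips where
  open import Data.Rational hiding (_≟_)
  open import Data.Rational.Properties
  open Rationals
  open MarkovInequality

  flip : Mono n → Input n → Input n
  flip B x i = lookup B i xor x i

  _∩_ _∖_ : Mono n → Mono n → Mono n
  _∩_ = zipWith _∧_
  _∖_ = zipWith (λ s b → s ∧ not b)

  Disjoint : Mono n → Mono n → Set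
  Disjoint S T = ∀ i → lookup S i ≡ true → lookup T i ≡ false

  AgreeOn : Bool → Mono n → Input n → Input n → Set
  AgreeOn b S y z = ∀ i → lookup S i ≡ b → y i ≡ z i

  monoVal-agree : ∀ (S : Mono n) {y z} → AgreeOn true S y z → monoVal S y ≡ monoVal S z
  monoVal-agree [] e = refl
  monoVal-agree (true ∷ S) e = cong₂ _*_ (cong bitℚ (e zero refl)) (monoVal-agree S (λ i → e (suc i)))
  monoVal-agree (false ∷ S) e = monoVal-agree S (λ i → e (suc i))

  ∩-⊆ʳ : ∀ (S B : Mono n) i → lookup (S ∩ B) i ≡ true → lookup B i ≡ true
  ∩-⊆ʳ S B i e with lookup S i | lookup B i | trans (sym (lookup-zipWith _∧_ i S B)) e
  ... | true | true | _ = refl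

  ∖-avoids : ∀ (S B : Mono n) i → lookup (S ∖ B) i ≡ true → lookup B i ≡ false
  ∖-avoids S B i e with lookup S i | lookup B i | trans (sym (lookup-zipWith _ i S B)) e
  ... | true | false | _ = refl

  monoVal-split : ∀ (S B : Mono n) x → monoVal S x ≡ monoVal (S ∩ B) x * monoVal (S ∖ B) x
  monoVal-split [] [] x = refl
  monoVal-split (true ∷ S) (true ∷ B) x = trans (cong (bitℚ (x zero) *_) (monoVal-split S B (λ i → x (suc i))))
    (sym (*-assoc (bitℚ (x zero)) (monoVal (S ∩ B) _) (monoVal (S ∖ B) _)))
  monoVal-split (true ∷ S) (false ∷ B) x = trans (cong (bitℚ (x zero) *_) (monoVal-split S B (λ i → x (suc i))))
    (lem (bitℚ (x zero)) (monoVal (S ∩ B) _) (monoVal (S ∖ B) _))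
    where
    lem : ∀ (a b c : ℚ) → a * (b * c) ≡ b * (a * c)
    lem = solve-∀ ℚ-ring
  monoVal-split (false ∷ S) (true ∷ B) x = monoVal-split S B (λ i → x (suc i))
  monoVal-split (false ∷ S) (false ∷ B) x = monoVal-split S B (λ i → x (suc i))

  size-split : ∀ (S B : Mono n) → size (S ∩ B) ℕ.+ size (S ∖ B) ≡ size S
  size-split [] [] = refl
  size-split (true ∷ S) (true ∷ B) = cong suc (size-split S B)
  size-split (true ∷ S) (false ∷ B) = trans (ℕₚ.+-suc _ _) (cong suc (size-split S B))
  size-split (false ∷ S) (true ∷ B) = size-split S B
  size-split (false ∷ S) (false ∷ B) = size-split S B

  monoVal-empty : ∀ (S : Mono n) x → size S ≡ 0 → monoVal S x ≡ 1ℚ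
  monoVal-empty [] x e = refl
  monoVal-empty (false ∷ S) x e = monoVal-empty S _ e

  -- The expectation of F at x with each block of Bs flipped independently with probability t.
  E : ℚ → List (Mono n) → (Input n → ℚ) → Input n → ℚ
  E t [] F x = F x
  E t (B ∷ Bs) F x = (1ℚ - t) * E t Bs F x + t * E t Bs F (flip B x)

  E-+ : ∀ t (Bs : List (Mono n)) F G x → E t Bs (λ y → F y + G y) x ≡ E t Bs F x + E t Bs G x
  E-+ t [] F G x = refl
  E-+ t (B ∷ Bs) F G x = trans
    (cong₂ (λ u v → (1ℚ - t) * u + t * v) (E-+ t Bs F G x) (E-+ t Bs F G (flip B x)))
    (lem (1ℚ - t) t (E t Bs F x) (E t Bs G x) (E t Bs F (flip B x)) (E t Bs G (flip B x)))
    where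
    lem : ∀ (s t a b c d : ℚ) → s * (a + b) + t * (c + d) ≡ (s * a + t * c) + (s * b + t * d)
    lem = solve-∀ ℚ-ring

  E-* : ∀ t (Bs : List (Mono n)) c F x → E t Bs (λ y → c * F y) x ≡ c * E t Bs F x
  E-* t [] c F x = refl
  E-* t (B ∷ Bs) c F x = trans
    (cong₂ (λ u v → (1ℚ - t) * u + t * v) (E-* t Bs c F x) (E-* t Bs c F (flip B x)))
    (lem (1ℚ - t) t c (E t Bs F x) (E t Bs F (flip B x)))
    where
    lem : ∀ (s t c a b : ℚ) → s * (c * a) + t * (c * b) ≡ c * (s * a + t * b)
    lem = solve-∀ ℚ-ring

  E-zero : ∀ (Bs : List (Mono n)) F x → E 0ℚ Bs F x ≡ F x
  E-zero [] F x = refl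
  E-zero (B ∷ Bs) F x = trans (lem (E 0ℚ Bs F x) (E 0ℚ Bs F (flip B x))) (E-zero Bs F x)
    where
    lem : ∀ (a b : ℚ) → (1ℚ - 0ℚ) * a + 0ℚ * b ≡ a
    lem = solve-∀ ℚ-ring

  -- Flips of the other blocks leave the variables of `S ∩ B` alone, and `S ∖ B` does not see
  -- whether `B` was flipped. Two points `y` and `z` are allowed so that the flipped and unflipped
  -- branches share the same second factor.
  E-factor : ∀ t (S B : Mono n) Bs {y z} → All (Disjoint B) Bs → AgreeOn false B y z →
    E t Bs (monoVal S) y ≡ monoVal (S ∩ B) y * E t Bs (monoVal (S ∖ B)) z
  E-factor t S B [] {y} {z} _ e = trans (monoVal-split S B y)
    (cong (monoVal (S ∩ B) y *_) (monoVal-agree (S ∖ B) λ i p → e i (∖-avoids S B i p)))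
  E-factor t S B (B′ ∷ Bs) {y} {z} (d ∷ ds) e = trans
    (cong₂ (λ u v → (1ℚ - t) * u + t * v) (E-factor t S B Bs ds e)
      (trans (E-factor t S B Bs ds (λ i p → cong (lookup B′ i xor_) (e i p)))
        (cong (_* E t Bs (monoVal (S ∖ B)) (flip B′ z)) (monoVal-agree (S ∩ B) λ i p →
          cong (_xor y i) (d i (∩-⊆ʳ S B i p))))))
    (lem (1ℚ - t) t (monoVal (S ∩ B) y) (E t Bs (monoVal (S ∖ B)) z) (E t Bs (monoVal (S ∖ B)) (flip B′ z)))
    where
    lem : ∀ (s t c a b : ℚ) → s * (c * a) + t * (c * b) ≡ c * (s * a + t * b)
    lem = solve-∀ ℚ-ring

  -- Each block meeting `S` contributes one factor affine in `t`, and a block missing `S`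
  -- contributes none. Disjoint blocks meeting `S` use up different variables of `S`, so there are
  -- at most `size S` such factors.
  E-monoVal-deg : ∀ (S : Mono n) {Bs} → AllPairs Disjoint Bs → ∀ x → PolyDeg (size S) (λ t → E t Bs (monoVal S) x)
  E-monoVal-deg S [] x = poly-const (size S) (monoVal S x)
  E-monoVal-deg S {B ∷ Bs} (d ∷ ds) x = go (size (S ∩ B)) refl
    where
    α β : ℚ
    α = monoVal (S ∩ B) x
    β = monoVal (S ∩ B) (flip B x)
    rest : ℚ → ℚ
    rest t = E t Bs (monoVal (S ∖ B)) x
    IH : PolyDeg (size (S ∖ B)) rest
    IH = E-monoVal-deg (S ∖ B) ds x
    factored : ∀ t → (1ℚ - t) * (α * rest t) + t * (β * rest t) ≡ E t (B ∷ Bs) (monoVal S) x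
    factored t = sym (cong₂ (λ u v → (1ℚ - t) * u + t * v) (E-factor t S B Bs d (λ _ _ → refl))
      (E-factor t S B Bs d (λ i p → cong (_xor x i) p)))
    lem : ∀ (t α β r : ℚ) → (α + (β - α) * t) * r ≡ (1ℚ - t) * (α * r) + t * (β * r)
    lem = solve-∀ ℚ-ring
    lem₁ : ∀ (t r : ℚ) → r ≡ (1ℚ - t) * (1ℚ * r) + t * (1ℚ * r)
    lem₁ = solve-∀ ℚ-ring
    go : ∀ k → size (S ∩ B) ≡ k → PolyDeg (size S) (λ t → E t (B ∷ Bs) (monoVal S) x)
    go zero e = subst (λ m → PolyDeg m (λ t → E t (B ∷ Bs) (monoVal S) x)) (trans (cong (ℕ._+ size (S ∖ B)) (sym e)) (size-split S B))
      (poly-cong (size (S ∖ B)) (λ t → trans (lem₁ t (rest t)) (trans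
        (cong₂ (λ u v → (1ℚ - t) * (u * rest t) + t * (v * rest t))
          (sym (monoVal-empty (S ∩ B) x e)) (sym (monoVal-empty (S ∩ B) (flip B x) e))) (factored t))) IH)
    go (suc k) e = poly-mono (ℕₚ.≤⇒≤′ bound)
      (poly-cong (suc (size (S ∖ B))) (λ t → trans (lem t α β (rest t)) (factored t))
        (poly-affine (size (S ∖ B)) α (β - α) IH))
      where
      bound : suc (size (S ∖ B)) ℕ.≤ size S
      bound = subst (suc (size (S ∖ B)) ℕ.≤_) (trans (cong (ℕ._+ size (S ∖ B)) (sym e)) (size-split S B))
        (ℕ.s≤s (ℕₚ.m≤n+m (size (S ∖ B)) k))

  E-evalPoly-deg : ∀ (p : Poly n) {d Bs} → DegLe p d → AllPairs Disjoint Bs → ∀ x →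
    PolyDeg d (λ t → E t Bs (evalPoly p) x)
  E-evalPoly-deg {n} p {d} {Bs} deg disj x = go (allMonos n)
    where
    term : ∀ S → PolyDeg d (λ t → E t Bs (λ y → p S * monoVal S y) x)
    term S with p S ≟ 0ℚ
    ... | yes e = poly-cong d (λ t → sym (trans (E-* t Bs (p S) (monoVal S) x)
        (trans (cong (_* E t Bs (monoVal S) x) e) (*-zeroˡ (E t Bs (monoVal S) x))))) (poly-const d 0ℚ)
    ... | no ne = poly-mono (ℕₚ.≤⇒≤′ (deg S ne)) (poly-cong (size S) (λ t → sym (E-* t Bs (p S) (monoVal S) x))
        (poly-* (size S) (p S) (E-monoVal-deg S disj x)))
    go : ∀ Ss → PolyDeg d (λ t → E t Bs (λ y → sumℚ (map (λ S → p S * monoVal S y) Ss)) x)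
    go [] = poly-cong d (λ t → sym (trans (E-* t Bs 0ℚ (λ _ → 0ℚ) x) (*-zeroˡ (E t Bs (λ _ → 0ℚ) x)))) (poly-const d 0ℚ)
    go (S ∷ Ss) = poly-cong d (λ t → sym (E-+ t Bs (λ y → p S * monoVal S y) _ x)) (poly-+ d (term S) (go Ss))

  module _ {t M : ℚ} (0≤t : 0ℚ ≤ t) (t≤1 : t ≤ 1ℚ) {F : Input n → ℚ} (F≤M : ∀ y → ∣ F y ∣ ≤ M) where

    private
      step : ∀ {a b A C} → ∣ a ∣ ≤ A → ∣ b ∣ ≤ C → ∣ (1ℚ - t) * a + t * b ∣ ≤ (1ℚ - t) * A + t * C
      step {a} {b} p q = ∣∣≤+ {(1ℚ - t) * a} {t * b}
        (∣∣≤* {1ℚ - t} {a} 0≤1-t (≤-reflexive (0≤p⇒∣p∣≡p 0≤1-t)) p)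
        (∣∣≤* {t} {b} 0≤t (≤-reflexive (0≤p⇒∣p∣≡p 0≤t)) q)
        where
        0≤1-t : 0ℚ ≤ 1ℚ - t
        0≤1-t = ≤⇒0≤- t≤1

    ∣E∣≤ : ∀ Bs x → ∣ E t Bs F x ∣ ≤ M
    ∣E∣≤ [] x = F≤M x
    ∣E∣≤ (B ∷ Bs) x = subst (∣ E t (B ∷ Bs) F x ∣ ≤_) (lem t M)
      (step {E t Bs F x} {E t Bs F (flip B x)} (∣E∣≤ Bs x) (∣E∣≤ Bs (flip B x)))
      where
      lem : ∀ (t M : ℚ) → (1ℚ - t) * M + t * M ≡ M
      lem = solve-∀ ℚ-ring

    module _ {η : ℚ} (0≤η : 0ℚ ≤ η) where

      -- With no flip at all the point stays at `y`; by Bernoulli's inequality this has probability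
      -- at least `1 - k t`.
      ∣E∣-low-start : ∀ Bs {y} → ∣ F y ∣ ≤ M - η → ∣ E t Bs F y ∣ ≤ M - η * (1ℚ - ι (length Bs) * t)
      ∣E∣-low-start [] {y} p = subst (∣ F y ∣ ≤_) (lem M η t) p
        where
        lem : ∀ (M η t : ℚ) → M - η ≡ M - η * (1ℚ - 0ℚ * t)
        lem = solve-∀ ℚ-ring
      ∣E∣-low-start (B ∷ Bs) {y} p = ≤-trans
        (step {E t Bs F y} {E t Bs F (flip B y)} (∣E∣-low-start Bs p) (∣E∣≤ Bs (flip B y)))
        (≤-by (η * (ι (length Bs) * (t * t))) (0≤* 0≤η (0≤* (0≤ι (length Bs)) (0≤* 0≤t 0≤t)))
          (lem t M η (ι (length Bs))))
        where
        lem : ∀ (t M η k : ℚ) → M - η * (1ℚ - (1ℚ + k) * t) ≡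
          ((1ℚ - t) * (M - η * (1ℚ - k * t)) + t * M) + η * (k * (t * t))
        lem = solve-∀ ℚ-ring

      -- Exactly one block is flipped with probability at least `k t (1 - k t)`, and each such
      -- outcome lies `η` below `M`. In the induction a flip of the head block reduces to
      -- `∣E∣-low-start` for the others.
      ∣E∣-low-neighbours : ∀ Bs {x} → All (λ B → ∣ F (flip B x) ∣ ≤ M - η) Bs →
        ∣ E t Bs F x ∣ ≤ M - η * (ι (length Bs) * t * (1ℚ - ι (length Bs) * t))
      ∣E∣-low-neighbours [] {x} _ = subst (∣ F x ∣ ≤_) (lem M η t) (F≤M x)
        where
        lem : ∀ (M η t : ℚ) → M ≡ M - η * (0ℚ * t * (1ℚ - 0ℚ * t))
        lem = solve-∀ ℚ-ring
      ∣E∣-low-neighbours (B ∷ Bs) {x} (p ∷ ps) = ≤-trans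
        (step {E t Bs F x} {E t Bs F (flip B x)} (∣E∣-low-neighbours Bs ps) (∣E∣-low-start Bs p))
        (≤-by (η * ((t * t) * (1ℚ + k * k * t))) (0≤* 0≤η (0≤* (0≤* 0≤t 0≤t)
          (0≤+ 0≤1 (0≤* (0≤* (0≤ι (length Bs)) (0≤ι (length Bs))) 0≤t))))
          (lem t M η k))
        where
        k = ι (length Bs)
        lem : ∀ (t M η k : ℚ) → M - η * ((1ℚ + k) * t * (1ℚ - (1ℚ + k) * t)) ≡
          ((1ℚ - t) * (M - η * (k * t * (1ℚ - k * t))) + t * (M - η * (1ℚ - k * t))) + η * ((t * t) * (1ℚ + k * k * t))
        lem = solve-∀ ℚ-ring

  -- The 16 comes from `markov`, the 4 from `s * (1ℚ - s)` being 1/4 in `few-blocks`.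
  64ℚ : ℚ
  64ℚ = 4ℚ * 16ℚ

  -- With k blocks, γ = 1/c and τ = 1/(2k), Markov's inequality is applied to g(v) = E (c τ v):
  -- v = γ corresponds to t = τ, and the nodes v = j² ≤ a² stay in [0,1].
  few-blocks : ∀ (p : Poly n) {a} → DegLe p a → ∀ {M η} → 0ℚ ≤ η → 0ℚ ≤ M → ∀ c′ →
    (∀ y → ∣ evalPoly p y ∣ ≤ M) → ∀ x → ∣ evalPoly p x ∣ ≡ M →
    ∀ B Bs → AllPairs Disjoint (B ∷ Bs) → All (λ B → ∣ evalPoly p (flip B x) ∣ ≤ M - η) (B ∷ Bs) →
    suc (suc c′) ℕ.* (a ℕ.* a) ℕ.≤ 2 ℕ.* length (B ∷ Bs) →
    ι (suc (suc c′)) * η ≤ 64ℚ * M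
  few-blocks p {a} deg {M} {η} 0≤η 0≤M c′ p≤M x px≡M B Bs disj low small = begin
    c * η ≡⟨ lem₃ c η ⟩
    c * (η * (1ℚ * 1ℚ)) ≡⟨ cong (λ z → c * (η * (z * z))) (sym 2s≡1) ⟩
    c * (η * ((2ℚ * s) * (2ℚ * s))) ≡⟨ lem₄ c η s ⟩
    4ℚ * (c * (η * (s * (2ℚ * s - s)))) ≡⟨ cong (λ z → 4ℚ * (c * (η * (s * (z - s))))) 2s≡1 ⟩
    4ℚ * (c * (η * (s * (1ℚ - s)))) ≤⟨ *-monoˡ 4ℚ (nonNegative⁻¹ 4ℚ) (*-monoˡ c (0≤ι (suc (suc c′))) drop) ⟩
    4ℚ * (c * (γ * (16ℚ * M))) ≡⟨ lem₅ c γ M ⟩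
    c * γ * (64ℚ * M) ≡⟨ cong (_* (64ℚ * M)) (ι*inv (suc c′)) ⟩
    1ℚ * (64ℚ * M) ≡⟨ *-identityˡ (64ℚ * M) ⟩
    64ℚ * M ∎
    where
    open ≤-Reasoning
    c k γ half τ κ s : ℚ
    c = ι (suc (suc c′))
    k = ι (suc (length Bs))
    γ = inv (suc c′)
    half = inv 1
    τ = half * inv (length Bs)
    κ = c * τ
    -- The expected number of flipped blocks, tuned to 1/2, where `s * (1ℚ - s)` is largest.
    s = k * τ
    0≤τ : 0ℚ ≤ τ
    0≤τ = 0≤* (0≤inv 1) (0≤inv (length Bs))
    2s≡1 : 2ℚ * s ≡ 1ℚ
    2s≡1 = trans (lem k half (inv (length Bs))) (cong₂ _*_ (ι*inv 1) (ι*inv (length Bs)))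
      where
      lem : ∀ (k h r : ℚ) → 2ℚ * (k * (h * r)) ≡ (2ℚ * h) * (k * r)
      lem = solve-∀ ℚ-ring
    κγ≡τ : κ * γ ≡ τ
    κγ≡τ = trans (lem c τ γ) (trans (cong (τ *_) (ι*inv (suc c′))) (*-identityʳ τ))
      where
      lem : ∀ (c τ γ : ℚ) → c * τ * γ ≡ τ * (c * γ)
      lem = solve-∀ ℚ-ring
    0≤κ : 0ℚ ≤ κ
    0≤κ = 0≤* (0≤ι (suc (suc c′))) 0≤τ
    -- The hypothesis `small` says `c a² ≤ 2k`, that is, the last node scaled by `κ = c/(2k)` is
    -- still a probability.
    κ-node : ∀ j → j ℕ.≤ a → κ * sq j ≤ 1ℚ
    κ-node j j≤a = begin
      κ * sq j ≤⟨ *-monoˡ κ 0≤κ (≤-trans (*-monoʳ (ι j) (0≤ι j) (ι-mono j≤a)) (*-monoˡ (ι a) (0≤ι a) (ι-mono j≤a))) ⟩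
      κ * sq a ≡⟨ lem₁ c τ (sq a) ⟩
      (c * sq a) * τ ≡⟨ cong (_* τ) (trans (cong (c *_) (sym (ι-* a a))) (sym (ι-* (suc (suc c′)) (a ℕ.* a)))) ⟩
      ι (suc (suc c′) ℕ.* (a ℕ.* a)) * τ ≤⟨ *-monoʳ τ 0≤τ (ι-mono small) ⟩
      ι (2 ℕ.* suc (length Bs)) * τ ≡⟨ cong (_* τ) (ι-* 2 (suc (length Bs))) ⟩
      2ℚ * k * τ ≡⟨ *-assoc 2ℚ k τ ⟩
      2ℚ * s ≡⟨ 2s≡1 ⟩
      1ℚ ∎
      where
      lem₁ : ∀ (c τ q : ℚ) → c * τ * q ≡ (c * q) * τ
      lem₁ = solve-∀ ℚ-ring
    lem₃ : ∀ (c η : ℚ) → c * η ≡ c * (η * (1ℚ * 1ℚ))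
    lem₃ = solve-∀ ℚ-ring
    lem₄ : ∀ (c η s : ℚ) → c * (η * ((2ℚ * s) * (2ℚ * s))) ≡ 4ℚ * (c * (η * (s * (2ℚ * s - s))))
    lem₄ = solve-∀ ℚ-ring
    lem₅ : ∀ (c γ M : ℚ) → 4ℚ * (c * (γ * (16ℚ * M))) ≡ c * γ * (64ℚ * M)
    lem₅ = solve-∀ ℚ-ring
    g : ℚ → ℚ
    g v = E (κ * v) (B ∷ Bs) (evalPoly p) x
    τ≤1 : τ ≤ 1ℚ
    τ≤1 = ≤-trans (≤-by (τ + 2ℚ * (ι (length Bs) * τ)) (0≤+ 0≤τ (0≤* (nonNegative⁻¹ 2ℚ) (0≤* (0≤ι (length Bs)) 0≤τ)))
      (lem (ι (length Bs)) τ)) (≤-reflexive 2s≡1)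
      where
      lem : ∀ (k τ : ℚ) → 2ℚ * ((1ℚ + k) * τ) ≡ τ + (τ + 2ℚ * (k * τ))
      lem = solve-∀ ℚ-ring
    gγ≤ : ∣ g γ ∣ ≤ M - η * (s * (1ℚ - s))
    gγ≤ = subst (λ t → ∣ E t (B ∷ Bs) (evalPoly p) x ∣ ≤ M - η * (s * (1ℚ - s))) (sym κγ≡τ)
      (∣E∣-low-neighbours 0≤τ τ≤1 p≤M 0≤η (B ∷ Bs) low)
    g0≡ : ∣ g 0ℚ ∣ ≡ M
    g0≡ = trans (cong ∣_∣ (trans (cong (λ t → E t (B ∷ Bs) (evalPoly p) x) (*-zeroʳ κ)) (E-zero (B ∷ Bs) (evalPoly p) x))) px≡M
    -- The two successors in `c` make it at least 2, as `markov` requires of `1/γ`.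
    2γ≤1 : γ + γ ≤ 1ℚ
    2γ≤1 = ≤-by (ι c′ * γ) (0≤* (0≤ι c′) (0≤inv (suc c′))) (trans (sym (ι*inv (suc c′))) (lem γ (ι c′)))
      where
      lem : ∀ (γ c : ℚ) → (1ℚ + (1ℚ + c)) * γ ≡ (γ + γ) + c * γ
      lem = solve-∀ ℚ-ring
    close : ∣ g 0ℚ - g γ ∣ ≤ γ * (16ℚ * M)
    close = markov a (poly-scale a κ (E-evalPoly-deg p deg disj x)) (0≤inv (suc c′)) 2γ≤1 0≤M
      (λ j j≤a → ∣E∣≤ (0≤* 0≤κ (0≤* (0≤ι j) (0≤ι j))) (κ-node j j≤a) p≤M (B ∷ Bs) x)
      (subst (λ t → ∣ E t (B ∷ Bs) (evalPoly p) x ∣ ≤ M) (sym κγ≡τ) (∣E∣≤ 0≤τ τ≤1 p≤M (B ∷ Bs) x))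
    drop : η * (s * (1ℚ - s)) ≤ γ * (16ℚ * M)
    drop = subst₂ _≤_ (lem₁ M u) (lem₂ M u w) (+-monoˡ-≤ (u - M) chain)
      where
      u = η * (s * (1ℚ - s))
      w = γ * (16ℚ * M)
      lem₁ : ∀ (M u : ℚ) → M + (u - M) ≡ u
      lem₁ = solve-∀ ℚ-ring
      lem₂ : ∀ (M u w : ℚ) → ((M - u) + w) + (u - M) ≡ w
      lem₂ = solve-∀ ℚ-ring
      lem₆ : ∀ (x y : ℚ) → x ≡ y + (x - y)
      lem₆ = solve-∀ ℚ-ring
      chain : M ≤ (M - u) + w
      chain = begin
        M ≡⟨ trans (sym g0≡) (cong ∣_∣ (lem₆ (g 0ℚ) (g γ))) ⟩
        ∣ g γ + (g 0ℚ - g γ) ∣ ≤⟨ ∣∣≤+ {g γ} {g 0ℚ - g γ} gγ≤ close ⟩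
        (M - u) + w ∎

-- Monomials of maximal degree, restrictions and disjoint families.

module MaximalMonomials where
  open import Data.Rational hiding (_≟_)
  open import Data.Rational.Properties
  open Rationals
  open BlockFlips

  sumℚ-map-cong : ∀ {A : Set} {f g : A → ℚ} → (∀ a → f a ≡ g a) → ∀ as → sumℚ (map f as) ≡ sumℚ (map g as)
  sumℚ-map-cong e [] = refl
  sumℚ-map-cong e (a ∷ as) = cong₂ _+_ (e a) (sumℚ-map-cong e as)

  sumℚ-++ : ∀ qs rs → sumℚ (qs ++ rs) ≡ sumℚ qs + sumℚ rs
  sumℚ-++ [] rs = sym (+-identityˡ (sumℚ rs))
  sumℚ-++ (q ∷ qs) rs = trans (cong (q +_) (sumℚ-++ qs rs)) (sym (+-assoc q (sumℚ qs) (sumℚ rs)))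

  sumℚ-map-linear : ∀ {A : Set} (f g : A → ℚ) c as →
    sumℚ (map (λ a → f a + c * g a) as) ≡ sumℚ (map f as) + c * sumℚ (map g as)
  sumℚ-map-linear f g c [] = lem c
    where
    lem : ∀ (c : ℚ) → 0ℚ ≡ 0ℚ + c * 0ℚ
    lem = solve-∀ ℚ-ring
  sumℚ-map-linear f g c (a ∷ as) = trans (cong (f a + c * g a +_) (sumℚ-map-linear f g c as))
    (lem (f a) (g a) c (sumℚ (map f as)) (sumℚ (map g as)))
    where
    lem : ∀ (x y c s t : ℚ) → (x + c * y) + (s + c * t) ≡ (x + s) + c * (y + t)
    lem = solve-∀ ℚ-ring

  evalPoly-cong : ∀ (p : Poly n) {x y} → x ≗ y → evalPoly p x ≡ evalPoly p y
  evalPoly-cong p e = sumℚ-map-cong (λ S → cong (p S *_) (monoVal-agree S λ i _ → e i)) (allMonos _)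

  evalPoly-linear : ∀ (p q : Poly n) c x → evalPoly (λ S → p S + c * q S) x ≡ evalPoly p x + c * evalPoly q x
  evalPoly-linear p q c x = trans
    (sumℚ-map-cong (λ S → lem (p S) (q S) c (monoVal S x)) (allMonos _))
    (sumℚ-map-linear (λ S → p S * monoVal S x) (λ S → q S * monoVal S x) c (allMonos _))
    where
    lem : ∀ (a b c m : ℚ) → (a + c * b) * m ≡ a * m + c * (b * m)
    lem = solve-∀ ℚ-ring

  slice : Bool → Poly (suc n) → Poly n
  slice b p S = p (b ∷ S)

  evalPoly-slices : ∀ (p : Poly (suc n)) x → evalPoly p x ≡
    evalPoly (slice false p) (x ∘ suc) + bitℚ (x zero) * evalPoly (slice true p) (x ∘ suc)
  evalPoly-slices {n} p x = begin
    sumℚ (map term (map (false ∷_) Ss ++ map (true ∷_) Ss))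
      ≡⟨ cong sumℚ (map-++ term (map (false ∷_) Ss) (map (true ∷_) Ss)) ⟩
    sumℚ (map term (map (false ∷_) Ss) ++ map term (map (true ∷_) Ss)) ≡⟨ sumℚ-++ (map term (map (false ∷_) Ss)) _ ⟩
    sumℚ (map term (map (false ∷_) Ss)) + sumℚ (map term (map (true ∷_) Ss))
      ≡⟨ cong₂ (λ as bs → sumℚ as + sumℚ bs) (sym (map-∘ Ss)) (sym (map-∘ Ss)) ⟩
    evalPoly (slice false p) (x ∘ suc) + sumℚ (map (λ S → p (true ∷ S) * (b * monoVal S (x ∘ suc))) Ss)
      ≡⟨ cong (evalPoly (slice false p) (x ∘ suc) +_) scaled ⟩
    evalPoly (slice false p) (x ∘ suc) + b * evalPoly (slice true p) (x ∘ suc) ∎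
    where
    open ≡-Reasoning
    Ss = allMonos n
    b = bitℚ (x zero)
    term : Mono (suc n) → ℚ
    term S = p S * monoVal S x
    t₁ : Mono n → ℚ
    t₁ S = p (true ∷ S) * monoVal S (x ∘ suc)
    scale : ∀ c as → sumℚ (map (λ S → c * t₁ S) as) ≡ c * sumℚ (map t₁ as)
    scale c [] = sym (*-zeroʳ c)
    scale c (S ∷ as) = trans (cong (c * t₁ S +_) (scale c as)) (sym (*-distribˡ-+ c (t₁ S) (sumℚ (map t₁ as))))
    lem : ∀ (a b m : ℚ) → a * (b * m) ≡ b * (a * m)
    lem = solve-∀ ℚ-ring
    scaled = trans (sumℚ-map-cong (λ S → lem (p (true ∷ S)) b (monoVal S (x ∘ suc))) Ss) (scale b Ss)

  DegLe-zero : ∀ {p : Poly n} {d} → DegLe p d → ∀ S → d ℕ.< size S → p S ≡ 0ℚ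
  DegLe-zero {p = p} deg S lt with p S ≟ 0ℚ
  ... | yes e = e
  ... | no ne = contradiction (deg S ne) (ℕₚ.<⇒≱ lt)

  evalPoly-constant : ∀ {p : Poly n} → DegLe p 0 → ∀ x y → evalPoly p x ≡ evalPoly p y
  evalPoly-constant {p = p} deg x y = sumℚ-map-cong term (allMonos _)
    where
    term : ∀ S → p S * monoVal S x ≡ p S * monoVal S y
    term S with p S ≟ 0ℚ
    ... | yes e = trans (cong (_* monoVal S x) e) (trans (*-zeroˡ (monoVal S x))
        (trans (sym (*-zeroˡ (monoVal S y))) (cong (_* monoVal S y) (sym e))))
    ... | no ne = cong (p S *_) (trans (monoVal-empty S x S≡∅) (sym (monoVal-empty S y S≡∅)))
      where S≡∅ = ℕₚ.n≤0⇒n≡0 (deg S ne)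

  _⊆_ : Mono n → Mono n → Set
  B ⊆ S = ∀ i → lookup B i ≡ true → lookup S i ≡ true

  -- On the subcube through x spanned by S, the coefficient of S in q is unchanged because no larger
  -- monomial occurs, so q is not identically zero there.
  nonzero-flip : ∀ (q : Poly n) S → q S ≢ 0ℚ → DegLe q (size S) → ∀ x →
    Σ (Mono n) λ B → B ⊆ S × evalPoly q (flip B x) ≢ 0ℚ
  nonzero-flip q [] ne deg x = [] , (λ ()) , λ e → ne (trans (lem (q [])) e)
    where
    lem : ∀ (c : ℚ) → c ≡ c * 1ℚ + 0ℚ
    lem = solve-∀ ℚ-ring
  nonzero-flip q (false ∷ S) ne deg x = extend (nonzero-flip q′ S ne′ deg′ (x ∘ suc))
    where
    b = bitℚ (x zero)
    q′ : Poly _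
    q′ T = q (false ∷ T) + b * q (true ∷ T)
    lem : ∀ (a b : ℚ) → a + b * 0ℚ ≡ a
    lem = solve-∀ ℚ-ring
    ne′ : q′ S ≢ 0ℚ
    ne′ e = ne (trans (sym (trans (cong (λ z → q (false ∷ S) + b * z) (DegLe-zero deg (true ∷ S) ℕₚ.≤-refl))
      (lem (q (false ∷ S)) b))) e)
    deg′ : DegLe q′ (size S)
    deg′ T T≢0 with size T ℕₚ.≤? size S
    ... | yes le = le
    ... | no gt = contradiction
      (trans (cong₂ (λ u v → u + b * v) (DegLe-zero deg (false ∷ T) (ℕₚ.≰⇒> gt))
        (DegLe-zero deg (true ∷ T) (ℕₚ.m<n⇒m<1+n (ℕₚ.≰⇒> gt)))) (lem 0ℚ b)) T≢0
    extend : (Σ (Mono _) λ B → B ⊆ S × evalPoly q′ (flip B (x ∘ suc)) ≢ 0ℚ) →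
      Σ (Mono _) λ B → B ⊆ (false ∷ S) × evalPoly q (flip B x) ≢ 0ℚ
    extend (B , B⊆S , ne) = false ∷ B , (λ { (suc i) e → B⊆S i e }) , λ e → ne (trans
      (trans (evalPoly-linear (slice false q) (slice true q) b (flip B (x ∘ suc)))
        (sym (evalPoly-slices q (flip (false ∷ B) x)))) e)
  nonzero-flip q (true ∷ S) ne deg x
    with nonzero-flip (slice true q) S ne (λ T T≢0 → ℕₚ.≤-pred (deg (true ∷ T) T≢0)) (x ∘ suc)
  ... | B , B⊆S , v≢0 = extend (evalPoly (slice false q) (flip B (x ∘ suc)) ≟ 0ℚ)
    where
    u v : ℚ
    u = evalPoly (slice false q) (flip B (x ∘ suc))
    v = evalPoly (slice true q) (flip B (x ∘ suc))
    inc : ∀ c → (c ∷ B) ⊆ (true ∷ S)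
    inc c zero e = refl
    inc c (suc i) e = B⊆S i e
    value : ∀ c → evalPoly q (flip (c ∷ B) x) ≡ u + bitℚ (c xor x zero) * v
    value c = evalPoly-slices q (flip (c ∷ B) x)
    not-xor : ∀ b → not b xor b ≡ true
    not-xor true = refl
    not-xor false = refl
    lem₀ : ∀ (u v : ℚ) → u + 0ℚ * v ≡ u
    lem₀ = solve-∀ ℚ-ring
    lem₁ : ∀ (v : ℚ) → 0ℚ + 1ℚ * v ≡ v
    lem₁ = solve-∀ ℚ-ring
    extend : Dec (u ≡ 0ℚ) → Σ (Mono _) λ B → B ⊆ (true ∷ S) × evalPoly q (flip B x) ≢ 0ℚ
    -- On the first variable the value is `u` at 0 and `u + v` at 1, with `v` nonzero. If `u` is
    -- zero the variable is set to 1, otherwise to 0; the head bit of the block is whatever flip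
    -- achieves this from `x zero`.
    extend (yes u≡0) = not (x zero) ∷ B , inc (not (x zero)) , λ e → v≢0 (trans
      (sym (trans (value (not (x zero))) (trans (cong₂ (λ a c → a + bitℚ c * v) u≡0 (not-xor (x zero))) (lem₁ v)))) e)
    extend (no u≢0) = x zero ∷ B , inc (x zero) , λ e → u≢0 (trans
      (sym (trans (value (x zero)) (trans (cong (λ c → u + bitℚ c * v) (xor-same (x zero))) (lem₀ u v)))) e)

  -- The fixed variable remains as a dummy whose monomials have coefficient zero, so every
  -- restriction lives over the same `n` and tree nodes need no reindexing.
  restrict : Fin n → Bool → Poly n → Poly n
  restrict zero b p (false ∷ S) = p (false ∷ S) + bitℚ b * p (true ∷ S)
  restrict zero b p (true ∷ S) = 0ℚ
  restrict (suc i) b p (s ∷ S) = restrict i b (slice s p) S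

  _[_≔_] : Input n → Fin n → Bool → Input n
  x [ i ≔ b ] = updateAt x i (const b)

  evalPoly-0 : ∀ (x : Input n) → evalPoly (λ _ → 0ℚ) x ≡ 0ℚ
  evalPoly-0 x = go (allMonos _)
    where
    go : ∀ Ss → sumℚ (map (λ S → 0ℚ * monoVal S x) Ss) ≡ 0ℚ
    go [] = refl
    go (S ∷ Ss) = cong₂ _+_ (*-zeroˡ (monoVal S x)) (go Ss)

  evalPoly-restrict : ∀ i b (p : Poly n) x → evalPoly (restrict i b p) x ≡ evalPoly p (x [ i ≔ b ])
  evalPoly-restrict zero b p x = begin
    evalPoly (restrict zero b p) x ≡⟨ evalPoly-slices (restrict zero b p) x ⟩
    evalPoly (λ S → p (false ∷ S) + bitℚ b * p (true ∷ S)) (x ∘ suc) + bitℚ (x zero) * evalPoly (λ _ → 0ℚ) (x ∘ suc)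
      ≡⟨ cong₂ (λ u v → u + bitℚ (x zero) * v)
          (evalPoly-linear (slice false p) (slice true p) (bitℚ b) (x ∘ suc)) (evalPoly-0 (x ∘ suc)) ⟩
    (u + bitℚ b * v) + bitℚ (x zero) * 0ℚ ≡⟨ lem (u + bitℚ b * v) (bitℚ (x zero)) ⟩
    u + bitℚ b * v ≡⟨ sym (evalPoly-slices p (x [ zero ≔ b ])) ⟩
    evalPoly p (x [ zero ≔ b ]) ∎
    where
    open ≡-Reasoning
    u v : ℚ
    u = evalPoly (slice false p) (x ∘ suc)
    v = evalPoly (slice true p) (x ∘ suc)
    lem : ∀ (u b : ℚ) → u + b * 0ℚ ≡ u
    lem = solve-∀ ℚ-ring
  evalPoly-restrict (suc i) b p x = trans (evalPoly-slices (restrict (suc i) b p) x)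
    (trans (cong₂ (λ u v → u + bitℚ (x zero) * v)
      (evalPoly-restrict i b (slice false p) (x ∘ suc)) (evalPoly-restrict i b (slice true p) (x ∘ suc)))
      (sym (evalPoly-slices p (x [ suc i ≔ b ]))))

  restrict-support : ∀ i b (p : Poly n) S → restrict i b p S ≢ 0ℚ →
    lookup S i ≡ false × (p S ≢ 0ℚ ⊎ Σ (Mono n) λ T → p T ≢ 0ℚ × size T ≡ suc (size S))
  restrict-support zero b p (false ∷ S) ne with p (false ∷ S) ≟ 0ℚ
  ... | no ne₀ = refl , inj₁ ne₀
  ... | yes e₀ = refl , inj₂ (true ∷ S , (λ e₁ → ne (trans (cong₂ (λ u v → u + bitℚ b * v) e₀ e₁) (lem (bitℚ b)))) , refl)
    where
    lem : ∀ (b : ℚ) → 0ℚ + b * 0ℚ ≡ 0ℚ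
    lem = solve-∀ ℚ-ring
  restrict-support zero b p (true ∷ S) ne = contradiction refl ne
  restrict-support (suc i) b p (s ∷ S) ne with restrict-support i b (slice s p) S ne
  ... | e , inj₁ ne′ = e , inj₁ ne′
  ... | e , inj₂ (T , neT , eT) = e , inj₂ (s ∷ T , neT , size-cons s eT)
    where
    size-cons : ∀ s {S T} → size T ≡ suc (size S) → size (s ∷ T) ≡ suc (size (s ∷ S))
    size-cons true e = cong suc e
    size-cons false e = e

  restrict-DegLe : ∀ i b {p : Poly n} {d} → DegLe p d → DegLe (restrict i b p) d
  restrict-DegLe i b {p} {d} deg S ne with restrict-support i b p S ne
  ... | _ , inj₁ ne′ = deg S ne′
  ... | _ , inj₂ (T , neT , eT) = ℕₚ.≤-trans (ℕₚ.n≤1+n (size S)) (subst (ℕ._≤ d) eT (deg T neT))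

  Top : Poly n → ℕ → Mono n → Set
  Top q d S = q S ≢ 0ℚ × size S ≡ d

  Hits : List (Fin n) → Poly n → ℕ → Set
  Hits vs q d = ∀ S → Top q d S → Any (λ i → lookup S i ≡ true) vs

  -- A top monomial of the restriction cannot arise only from adding `i` to it, since that monomial
  -- would exceed the degree bound. It was therefore already present in `q` and avoids `i`, so
  -- another variable of the list hits it.
  restrict-Hits : ∀ {i vs} b {q : Poly n} {d} → DegLe q d → Hits (i ∷ vs) q d → Hits vs (restrict i b q) d
  restrict-Hits {i = i} b {q} {d} deg hits S (ne , e) with restrict-support i b q S ne
  ... | _ , inj₂ (T , neT , eT) = contradiction (subst (ℕ._≤ d) (trans eT (cong suc e)) (deg T neT)) (ℕₚ.1+n≰n)
  ... | i∉S , inj₁ ne′ with hits S (ne′ , e)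
  ... | here i∈S = contradiction (trans (sym i∈S) i∉S) λ ()
  ... | there h = h

  allMonos-complete : ∀ (S : Mono n) → S ∈ allMonos n
  allMonos-complete [] = here refl
  allMonos-complete (false ∷ S) = ∈-++⁺ˡ (∈-map⁺ (false ∷_) (allMonos-complete S))
  allMonos-complete {suc n} (true ∷ S) = ∈-++⁺ʳ (map (false ∷_) (allMonos n)) (∈-map⁺ (true ∷_) (allMonos-complete S))

  members : Mono n → List (Fin n)
  members [] = []
  members (true ∷ S) = zero ∷ map suc (members S)
  members (false ∷ S) = map suc (members S)

  length-members : ∀ (S : Mono n) → length (members S) ≡ size S
  length-members [] = refl
  length-members (true ∷ S) = cong suc (trans (length-map suc (members S)) (length-members S))
  length-members (false ∷ S) = trans (length-map suc (members S)) (length-members S)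

  ∈-members : ∀ (S : Mono n) i → lookup S i ≡ true → i ∈ members S
  ∈-members (true ∷ S) zero e = here refl
  ∈-members (true ∷ S) (suc i) e = there (∈-map⁺ suc (∈-members S i e))
  ∈-members (false ∷ S) (suc i) e = ∈-map⁺ suc (∈-members S i e)

  Meets : Mono n → Mono n → Set
  Meets S T = ∃ λ i → lookup S i ≡ true × lookup T i ≡ true

  meets? : ∀ (S T : Mono n) → Dec (Meets S T)
  meets? S T = any? λ i → (lookup S i ≟ᵇ true) ×-dec (lookup T i ≟ᵇ true)

  ¬meets⇒disjoint : ∀ (S T : Mono n) → ¬ Meets S T → Disjoint S T
  ¬meets⇒disjoint S T ¬m i e with lookup T i in eT
  ... | true = contradiction (i , e , eT) ¬m
  ... | false = refl

  nonempty : ∀ (S : Mono n) {d} → size S ≡ suc d → ∃ λ i → lookup S i ≡ true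
  nonempty (true ∷ S) e = zero , refl
  nonempty (false ∷ S) e with nonempty S e
  ... | i , eᵢ = suc i , eᵢ

  record MaximalFamily (q : Poly n) (d : ℕ) (Ss : List (Mono n)) : Set where
    field
      family : List (Mono n)
      disjoint : AllPairs Disjoint family
      top : All (Top q d) family
      maximal : ∀ {S} → S ∈ Ss → Top q d S → Any (Meets S) family

  open MaximalFamily

  -- A greedy scan of `Ss`. The size `suc d` is positive, so a chosen monomial meets itself and is
  -- covered by `maximal` as well.
  maximalFamily : ∀ (q : Poly n) d Ss → MaximalFamily q (suc d) Ss
  maximalFamily q d [] = record { family = [] ; disjoint = [] ; top = [] ; maximal = λ () }
  maximalFamily {n} q d (S ∷ Ss) = extend (¬? (q S ≟ 0ℚ) ×-dec (size S ℕₚ.≟ suc d)) (Any.any? (meets? S) (family F))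
    where
    F = maximalFamily q d Ss
    extend : Dec (Top q (suc d) S) → Dec (Any (Meets S) (family F)) → MaximalFamily q (suc d) (S ∷ Ss)
    extend (yes t) (no ¬m) = record
      { family = S ∷ family F
      ; disjoint = All.map (λ {T} → ¬meets⇒disjoint S T) (¬Any⇒All¬ (family F) ¬m) ∷ disjoint F
      ; top = t ∷ top F
      ; maximal = λ { (here refl) t′ → let i , e = nonempty S (proj₂ t) in here (i , e , e)
                    ; (there S∈) t′ → there (maximal F S∈ t′) } }
    extend (yes t) (yes m) = record
      { family = family F ; disjoint = disjoint F ; top = top F
      ; maximal = λ { (here refl) _ → m ; (there S∈) t′ → maximal F S∈ t′ } }
    extend (no ¬t) _ = record
      { family = family F ; disjoint = disjoint F ; top = top F
      ; maximal = λ { (here refl) t′ → contradiction t′ ¬t ; (there S∈) t′ → maximal F S∈ t′ } }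

  length-concatMap-members : ∀ {q : Poly n} {d Ms} → All (Top q d) Ms → length (concatMap members Ms) ≡ length Ms ℕ.* d
  length-concatMap-members [] = refl
  length-concatMap-members {Ms = M ∷ Ms} ((_ , e) ∷ ts) = trans (length-++ (members M))
    (cong₂ ℕ._+_ (trans (length-members M) e) (length-concatMap-members ts))

  meets⇒hits : ∀ (S : Mono n) {Ms} → Any (Meets S) Ms → Any (λ i → lookup S i ≡ true) (concatMap members Ms)
  meets⇒hits S {M ∷ Ms} (here (i , eS , eM)) = lose (∈-++⁺ˡ (∈-members M i eM)) eS
  meets⇒hits S {M ∷ Ms} (there m) = Any-++ʳ (members M) (meets⇒hits S m)

  -- Blocks inside disjoint monomials are disjoint, and `Pointwise` keeps their number equal to that
  -- of the monomials, so a bound on blocks bounds the family.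
  sensitive-blocks : ∀ {q : Poly n} {d} x → DegLe q d → ∀ {Ms} → All (Top q d) Ms → AllPairs Disjoint Ms →
    Σ (List (Mono n)) λ Bs → Pointwise _⊆_ Bs Ms × AllPairs Disjoint Bs × All (λ B → evalPoly q (flip B x) ≢ 0ℚ) Bs
  sensitive-blocks x deg [] [] = [] , [] , [] , []
  sensitive-blocks {q = q} x deg {M ∷ Ms} ((ne , e) ∷ ts) (d ∷ ds)
    with nonzero-flip q M ne (subst (DegLe q) (sym e) deg) x | sensitive-blocks x deg ts ds
  ... | B , B⊆M , neB | Bs , Bs⊆Ms , disj , nes = B ∷ Bs , B⊆M ∷ Bs⊆Ms , shrink d Bs⊆Ms ∷ disj , neB ∷ nes
    where
    shrink : ∀ {Ms Bs} → All (Disjoint M) Ms → Pointwise _⊆_ Bs Ms → All (Disjoint B) Bs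
    shrink [] [] = []
    shrink (d ∷ ds) (_∷_ {x = B′} B′⊆ Bs⊆) = avoid ∷ shrink ds Bs⊆
      where
      avoid : Disjoint B B′
      avoid i i∈B with lookup B′ i in i∈B′
      ... | false = refl
      ... | true = trans (sym (B′⊆ i i∈B′)) (d i (B⊆M i i∈B))

  -- Inputs are functions, so an input is only pointwise equal to its head prepended to its tail;
  -- `F` has to respect this for the two half-cubes to cover everything.
  argmax : ∀ n (F : Input n → ℚ) → (∀ {x y} → x ≗ y → F x ≡ F y) → Σ (Input n) λ x → ∀ y → F y ≤ F x
  argmax zero F ext = (λ ()) , λ y → ≤-reflexive (ext λ ())
  argmax (suc n) F ext = choose (≤-total (F (candidate false)) (F (candidate true)))
    where
    best : ∀ b → Σ (Input n) λ x → ∀ y → F (b VF.∷ y) ≤ F (b VF.∷ x)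
    best b = argmax n (λ z → F (b VF.∷ z)) (λ e → ext λ { zero → refl ; (suc i) → e i })
    candidate : Bool → Input (suc n)
    candidate b = b VF.∷ proj₁ (best b)
    below : ∀ y → F y ≤ F (candidate (y zero))
    below y = ≤-trans (≤-reflexive (ext λ { zero → refl ; (suc i) → refl })) (proj₂ (best (y zero)) (y ∘ suc))
    choose : F (candidate false) ≤ F (candidate true) ⊎ F (candidate true) ≤ F (candidate false) →
      Σ (Input (suc n)) λ x → ∀ y → F y ≤ F x
    choose (inj₁ le) = candidate true , λ y → ≤-trans (below y) (bound (y zero))
      where
      bound : ∀ b → F (candidate b) ≤ F (candidate true)
      bound true = ≤-refl
      bound false = le
    choose (inj₂ ge) = candidate false , λ y → ≤-trans (below y) (bound (y zero))
      where
      bound : ∀ b → F (candidate b) ≤ F (candidate false)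
      bound true = ge
      bound false = ≤-refl

-- The choice of the constant and the construction of the decision tree.

module DecisionTrees where
  open import Data.Rational hiding (_≟_)
  open import Data.Rational.Properties
  open ℤ using (+_; -[1+_])
  open Rationals
  open BlockFlips
  open MaximalMonomials

  toℚᵘ-ι : ∀ m → toℚᵘ (ι m) ℚᵘ.≃ ℚᵘ.mkℚᵘ (+ m) 0
  toℚᵘ-ι zero = ℚᵘₚ.≃-refl
  toℚᵘ-ι (suc m) = ℚᵘₚ.≃-trans (toℚᵘ-homo-+ 1ℚ (ι m))
    (ℚᵘₚ.≃-trans (ℚᵘₚ.+-congʳ (toℚᵘ 1ℚ) (toℚᵘ-ι m)) (ℚᵘ.*≡* (cong (λ z → (+ 1 ℤ.+ z) ℤ.* + 1) (ℤₚ.*-identityʳ (+ m)))))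

  ≤ι : ∀ q → q ≤ ι ℤ.∣ ↥ q ∣
  ≤ι q@(mkℚ i d _) = toℚᵘ-cancel-≤ (ℚᵘₚ.≤-trans (ℚᵘ.*≤* bound) (ℚᵘₚ.≤-reflexive (ℚᵘₚ.≃-sym (toℚᵘ-ι ℤ.∣ i ∣))))
    where
    open ℤₚ.≤-Reasoning
    bound : i ℤ.* + 1 ℤ.≤ + ℤ.∣ i ∣ ℤ.* + suc d
    bound = begin
      i ℤ.* + 1 ≡⟨ ℤₚ.*-identityʳ i ⟩
      i ≤⟨ i≤∣i∣ i ⟩
      + ℤ.∣ i ∣ ≤⟨ ℤ.+≤+ (ℕₚ.m≤m*n ℤ.∣ i ∣ (suc d)) ⟩
      + (ℤ.∣ i ∣ ℕ.* suc d) ≡⟨ ℤₚ.pos-* ℤ.∣ i ∣ (suc d) ⟩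
      + ℤ.∣ i ∣ ℤ.* + suc d ∎
      where
      i≤∣i∣ : ∀ i → i ℤ.≤ + ℤ.∣ i ∣
      i≤∣i∣ (+ m) = ℤₚ.≤-refl
      i≤∣i∣ (-[1+ m ]) = ℤ.-≤+

  -- The witness is the absolute numerator of `r/δ`, which bounds `r/δ` because denominators are at
  -- least 1. One successor gives strictness; the second fits the form of the factor in
  -- `few-blocks`.
  archimedean : ∀ {δ} → 0ℚ < δ → ∀ r → Σ ℕ λ c → r < ι (suc (suc c)) * δ
  archimedean {δ} 0<δ r = ℤ.∣ ↥ (r * δ⁻¹) ∣ , <-≤-trans r<
    (*-monoʳ {1ℚ + r * δ⁻¹} δ (<⇒≤ 0<δ) (+-monoʳ-≤ 1ℚ (≤-trans (≤ι (r * δ⁻¹))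
      (≤-by 1ℚ 0≤1 (+-comm 1ℚ (ι ℤ.∣ ↥ (r * δ⁻¹) ∣))))))
    where
    δ⁻¹ : ℚ
    δ⁻¹ = (1/ δ) {{pos⇒nonZero δ {{positive 0<δ}}}}
    lem : ∀ (r i d : ℚ) → (1ℚ + r * i) * d ≡ r * (d * i) + d
    lem = solve-∀ ℚ-ring
    r< : r < (1ℚ + r * δ⁻¹) * δ
    r< = subst₂ _<_ (+-identityʳ r) (sym (trans (lem r δ⁻¹ δ) (cong (_+ δ)
      (trans (cong (r *_) (*-inverseʳ δ {{pos⇒nonZero δ {{positive 0<δ}}}})) (*-identityʳ r))))) (+-monoʳ-< r 0<δ)

  -- The relation between the two polynomials with `f` eliminated, `q = 0` standing for `f = 1`; in
  -- this form it passes to restrictions directly.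
  Separates : ℚ → Poly n → Poly n → Set
  Separates ε p q = ∀ x → (evalPoly q x ≡ 0ℚ × 1ℚ ≤ ∣ evalPoly p x ∣) ⊎ (evalPoly q x ≢ 0ℚ × ∣ evalPoly p x ∣ ≤ ε)

  restrict-Separates : ∀ {ε} i b {p q : Poly n} → Separates ε p q → Separates ε (restrict i b p) (restrict i b q)
  restrict-Separates i b {p} {q} sep x with sep (x [ i ≔ b ])
  ... | inj₁ (e , le) = inj₁ (trans (evalPoly-restrict i b q x) e
      , subst (λ z → 1ℚ ≤ ∣ z ∣) (sym (evalPoly-restrict i b p x)) le)
  ... | inj₂ (ne , le) = inj₂ ((λ e → ne (trans (sym (evalPoly-restrict i b q x)) e))
      , subst (λ z → ∣ z ∣ ≤ _) (sym (evalPoly-restrict i b p x)) le)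

  ZeroTest : Poly n → DTree n → Set
  ZeroTest q t = ∀ x → runTree t x ≡ does (evalPoly q x ≟ 0ℚ)

  ZeroTest-node : ∀ i (q : Poly n) t₀ t₁ → ZeroTest (restrict i false q) t₀ → ZeroTest (restrict i true q) t₁ →
    ZeroTest q (node i t₀ t₁)
  ZeroTest-node i q t₀ t₁ h₀ h₁ x with x i in eq
  ... | true = trans (h₁ x) (cong (λ z → does (z ≟ 0ℚ)) (trans (evalPoly-restrict i true q x)
      (evalPoly-cong q (updateAt-id-local i x (sym eq)))))
  ... | false = trans (h₀ x) (cong (λ z → does (z ≟ 0ℚ)) (trans (evalPoly-restrict i false q x)
      (evalPoly-cong q (updateAt-id-local i x (sym eq)))))

  -- Once all variables of a hitting list are fixed, no monomial of degree `e + 1` is left on any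
  -- branch, so `rest` takes over at degree `e`.
  query : ∀ {ε a e d} →
    (∀ (p q : Poly n) → DegLe p a → Separates ε p q → DegLe q e → Σ (DTree n) λ t → ZeroTest q t × depth t ℕ.≤ d) →
    ∀ vs (p q : Poly n) → DegLe p a → Separates ε p q → DegLe q (suc e) → Hits vs q (suc e) →
    Σ (DTree n) λ t → ZeroTest q t × depth t ℕ.≤ length vs ℕ.+ d
  query {e = e} rest [] p q degp sep degq hits = rest p q degp sep lower
    where
    lower : DegLe q e
    lower S ne with ℕₚ.m≤n⇒m<n∨m≡n (degq S ne)
    ... | inj₁ lt = ℕₚ.≤-pred lt
    ... | inj₂ eq with () ← hits S (ne , eq)
  query rest (v ∷ vs) p q degp sep degq hits = node v (proj₁ (branch false)) (proj₁ (branch true))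
    , ZeroTest-node v q (proj₁ (branch false)) (proj₁ (branch true)) (proj₁ (proj₂ (branch false))) (proj₁ (proj₂ (branch true)))
    , ℕ.s≤s (ℕₚ.⊔-lub (proj₂ (proj₂ (branch false))) (proj₂ (proj₂ (branch true))))
    where
    branch : ∀ b → Σ (DTree _) λ t → ZeroTest (restrict v b q) t × depth t ℕ.≤ length vs ℕ.+ _
    branch b = query rest vs (restrict v b p) (restrict v b q) (restrict-DegLe v b degp)
      (restrict-Separates v b {p} {q} sep) (restrict-DegLe v b degq) (restrict-Hits b degq hits)

  module _ {ε : ℚ} (0≤ε : 0ℚ ≤ ε) (ε<1 : ε < 1ℚ) where

    0<1-ε : 0ℚ < 1ℚ - ε
    0<1-ε = subst (_< 1ℚ - ε) (+-inverseʳ ε) (+-monoˡ-< (- ε) ε<1)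

    c : ℕ
    c = proj₁ (archimedean 0<1-ε 64ℚ)

    C : ℕ
    C = suc (suc c)

    -- If `2k ≥ C a²`, `few-blocks` with the drop `η = (1 - ε) M` gives `C (1 - ε) M ≤ 64 M`,
    -- against the choice of `C`.
    few-sensitive-blocks : ∀ {p : Poly n} {a} → DegLe p a → ∀ x → 1ℚ ≤ ∣ evalPoly p x ∣ →
      (∀ y → ∣ evalPoly p y ∣ ≤ ∣ evalPoly p x ∣) →
      ∀ Bs → AllPairs Disjoint Bs → All (λ B → ∣ evalPoly p (flip B x) ∣ ≤ ε) Bs → length Bs ℕ.≤ C ℕ.* (a ℕ.* a)
    few-sensitive-blocks deg x 1≤M max [] disj low = ℕ.z≤n
    few-sensitive-blocks {p = p} {a} deg x 1≤M max (B ∷ Bs) disj low = go (C ℕ.* (a ℕ.* a) ℕₚ.≤? 2 ℕ.* length (B ∷ Bs))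
      where
      M δ : ℚ
      M = ∣ evalPoly p x ∣
      δ = 1ℚ - ε
      0<M : 0ℚ < M
      0<M = <-≤-trans (positive⁻¹ 1ℚ) 1≤M
      lem : ∀ (M ε : ℚ) → M - (1ℚ - ε) * M ≡ ε + ε * (M - 1ℚ)
      lem = solve-∀ ℚ-ring
      -- The right side is `ε M`, and `M ≥ 1`; thus the drop can be taken proportional to `M`.
      ε≤M-η : ε ≤ M - δ * M
      ε≤M-η = ≤-by (ε * (M - 1ℚ)) (0≤* 0≤ε (≤⇒0≤- 1≤M)) (lem M ε)
      go : Dec (C ℕ.* (a ℕ.* a) ℕ.≤ 2 ℕ.* length (B ∷ Bs)) → length (B ∷ Bs) ℕ.≤ C ℕ.* (a ℕ.* a)
      go (no ≰) = ℕₚ.≤-trans (ℕₚ.m≤n*m (length (B ∷ Bs)) 2) (ℕₚ.<⇒≤ (ℕₚ.≰⇒> ≰))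
      go (yes small) = contradiction
        (<-≤-trans (*-monoˡ-<-pos M {{positive 0<M}} (proj₂ (archimedean 0<1-ε 64ℚ)))
          (≤-trans (≤-reflexive (*-assoc (ι C) δ M))
            (few-blocks p deg (0≤* (<⇒≤ 0<1-ε) (<⇒≤ 0<M)) (<⇒≤ 0<M) c max x refl B Bs disj
              (All.map (λ le → ≤-trans le ε≤M-η) low) small)))
        (<-irrefl refl)

    -- Induction on the degree of `q`. The list queried contains every variable of a maximal
    -- disjoint family of top monomials, so it hits all of them; its length is at most `C a²` times
    -- their common size.
    zeroTest : ∀ b {a} (p q : Poly n) → DegLe p a → Separates ε p q → DegLe q b →
      Σ (DTree n) λ t → ZeroTest q t × depth t ℕ.≤ C ℕ.* (a ℕ.* a) ℕ.* (b ℕ.* b)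
    zeroTest zero p q degp sep degq = leaf (does (evalPoly q (const false) ≟ 0ℚ))
      , (λ x → cong (λ z → does (z ≟ 0ℚ)) (evalPoly-constant degq (const false) x)) , ℕ.z≤n
    zeroTest {n} (suc e) {a} p q degp sep degq
      with argmax n (λ x → ∣ evalPoly p x ∣) (λ e → cong ∣_∣ (evalPoly-cong p e))
    ... | x , max with 1ℚ ≤? ∣ evalPoly p x ∣
    -- When `|p|` stays below 1 everywhere, `Separates` leaves only the case `q ≠ 0`, and no query
    -- is necessary.
    ... | no ≰ = leaf false , (λ y → sym (dec-false (evalPoly q y ≟ 0ℚ) (nonzero y))) , ℕ.z≤n
      where
      nonzero : ∀ y → evalPoly q y ≢ 0ℚ
      nonzero y with sep y
      ... | inj₁ (_ , le) = contradiction (≤-trans le (max y)) ≰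
      ... | inj₂ (ne , _) = ne
    ... | yes 1≤M = shallow (query (zeroTest e) vs p q degp sep degq hits)
      where
      open MaximalFamily (maximalFamily q e (allMonos n))
      vs : List (Fin n)
      vs = concatMap members family
      hits : Hits vs q (suc e)
      hits S t = meets⇒hits S (maximal (allMonos-complete S) t)
      low : ∀ {B} → evalPoly q (flip B x) ≢ 0ℚ → ∣ evalPoly p (flip B x) ∣ ≤ ε
      low {B} ne with sep (flip B x)
      ... | inj₁ (e , _) = contradiction e ne
      ... | inj₂ (_ , le) = le
      few : length family ℕ.≤ C ℕ.* (a ℕ.* a)
      few with sensitive-blocks x degq top disjoint
      ... | Bs , Bs⊆ , disj , nes = subst (ℕ._≤ C ℕ.* (a ℕ.* a)) (Pointwise-length Bs⊆)
        (few-sensitive-blocks degp x 1≤M max Bs disj (All.map (λ {B} → low {B}) nes))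
      K : ℕ
      K = C ℕ.* (a ℕ.* a)
      lem : ∀ K e → K ℕ.* suc e ℕ.+ K ℕ.* (e ℕ.* e) ℕ.+ K ℕ.* e ≡ K ℕ.* (suc e ℕ.* suc e)
      lem = solve-∀ⁿ
      shallow : (Σ (DTree n) λ t → ZeroTest q t × depth t ℕ.≤ length vs ℕ.+ K ℕ.* (e ℕ.* e)) →
        Σ (DTree n) λ t → ZeroTest q t × depth t ℕ.≤ K ℕ.* (suc e ℕ.* suc e)
      shallow (t , h , le) = t , h , (begin
        depth t ≤⟨ le ⟩
        length vs ℕ.+ K ℕ.* (e ℕ.* e) ≡⟨ cong (ℕ._+ K ℕ.* (e ℕ.* e)) (length-concatMap-members top) ⟩
        length family ℕ.* suc e ℕ.+ K ℕ.* (e ℕ.* e) ≤⟨ ℕₚ.+-monoˡ-≤ (K ℕ.* (e ℕ.* e)) (ℕₚ.*-monoˡ-≤ (suc e) few) ⟩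
        K ℕ.* suc e ℕ.+ K ℕ.* (e ℕ.* e) ≤⟨ ℕₚ.m≤m+n _ (K ℕ.* e) ⟩
        K ℕ.* suc e ℕ.+ K ℕ.* (e ℕ.* e) ℕ.+ K ℕ.* e ≡⟨ lem K e ⟩
        K ℕ.* (suc e ℕ.* suc e) ∎)
        where open ℕₚ.≤-Reasoning

    -- Only pointwise agreement of `g` with `negF f` is asked, so that `negF f` and `f` can take the
    -- places of `f` and `g`: double negation is the identity only pointwise.
    HasDLe-ndeg : ∀ {f g : BoolFun n} {a b} → (∀ x → g x ≡ negF f x) → HasNdegLe ε f a → HasNdegLe 0ℚ g b →
      HasDLe f (C ℕ.* (a ℕ.* a) ℕ.* (b ℕ.* b))
    HasDLe-ndeg {f = f} {g} {a} {b} g≡¬f (p , ndp , degp) (q , ndq , degq) = finish (zeroTest b p q degp sep degq)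
      where
      zero-on-true : ∀ x → f x ≡ true → evalPoly q x ≡ 0ℚ
      zero-on-true x fx = ∣p∣≡0⇒p≡0 (evalPoly q x) (≤-antisym
        (proj₁ (ndq x) (trans (g≡¬f x) (cong (if_then false else true) fx))) (0≤∣p∣ (evalPoly q x)))
      nonzero-on-false : ∀ x → f x ≡ false → evalPoly q x ≢ 0ℚ
      nonzero-on-false x fx e = <-irrefl refl (<-≤-trans (positive⁻¹ 1ℚ) (subst (λ z → 1ℚ ≤ ∣ z ∣) e
        (proj₂ (ndq x) (trans (g≡¬f x) (cong (if_then false else true) fx)))))
      sep : Separates ε p q
      sep x with f x in fx
      ... | true = inj₁ (zero-on-true x fx , proj₂ (ndp x) fx)
      ... | false = inj₂ (nonzero-on-false x fx , proj₁ (ndp x) fx)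
      decides : ∀ x → does (evalPoly q x ≟ 0ℚ) ≡ f x
      decides x with f x in fx
      ... | true = dec-true (evalPoly q x ≟ 0ℚ) (zero-on-true x fx)
      ... | false = dec-false (evalPoly q x ≟ 0ℚ) (nonzero-on-false x fx)
      finish : (Σ (DTree _) λ t → ZeroTest q t × depth t ℕ.≤ C ℕ.* (a ℕ.* a) ℕ.* (b ℕ.* b)) → HasDLe f (C ℕ.* (a ℕ.* a) ℕ.* (b ℕ.* b))
      finish (t , h , le) = t , (λ x → trans (h x) (decides x)) , le

  HasDLe-negF : ∀ {f : BoolFun n} {d} → HasDLe (negF f) d → HasDLe f d
  HasDLe-negF {n} {f} (t , comp , le) = negTree t , comp′ , subst (ℕ._≤ _) (sym (depth-negTree t)) le
    where
    flipBool : Bool → Bool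
    flipBool b = if b then false else true
    flipBool² : ∀ b → flipBool (flipBool b) ≡ b
    flipBool² true = refl
    flipBool² false = refl
    negTree : DTree n → DTree n
    negTree (leaf b) = leaf (flipBool b)
    negTree (node i t₀ t₁) = node i (negTree t₀) (negTree t₁)
    depth-negTree : ∀ t → depth (negTree t) ≡ depth t
    depth-negTree (leaf b) = refl
    depth-negTree (node i t₀ t₁) = cong₂ (λ u v → suc (u ℕ.⊔ v)) (depth-negTree t₀) (depth-negTree t₁)
    run-negTree : ∀ t x → runTree (negTree t) x ≡ flipBool (runTree t x)
    run-negTree (leaf b) x = refl
    run-negTree (node i t₀ t₁) x with x i
    ... | true = run-negTree t₁ x
    ... | false = run-negTree t₀ x
    comp′ : ∀ x → runTree (negTree t) x ≡ f x
    comp′ x = trans (run-negTree t x) (trans (cong flipBool (comp x)) (flipBool² (f x)))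

  negF-involutive : ∀ (f : BoolFun n) x → f x ≡ negF (negF f) x
  negF-involutive f x with f x
  ... | true = refl
  ... | false = refl

open DecisionTrees using (C; HasDLe-ndeg; HasDLe-negF; negF-involutive)
open import Data.Nat using (ℕ; _≤_; _*_; _^_)
open import Data.Rational using (ℚ; 0ℚ; 1ℚ) renaming (_≤_ to _≤ℚ_; _<_ to _<ℚ_)

theorem4p6 : (ε : ℚ) → 0ℚ ≤ℚ ε → ε <ℚ 1ℚ →
    Σ ℕ λ C → ∀ n (f : BoolFun n) (D a b c d : ℕ) → IsD f D →
    IsNdegε ε f a → IsNdeg (negF f) b → IsNdeg f c → IsNdegε ε (negF f) d →
    (D ≤ C * (a ^ 2) * (b ^ 2)) × (D ≤ C * (c ^ 2) * (d ^ 2))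
theorem4p6 ε 0≤ε ε<1 = K , λ n f D a b c d (_ , minimal) (pf , _) (qf , _) (pc , _) (qd , _) →
    subst (D ≤_) (squares K a b) (minimal _ (HasDLe-ndeg 0≤ε ε<1 (λ _ → refl) pf qf))
  -- Here the roles are exchanged: the tree is built for `negF f`, which has the `ε`-polynomial, and
  -- its leaves are then negated.
  , subst (D ≤_) (squares-swap K c d)
      (minimal _ (HasDLe-negF (HasDLe-ndeg 0≤ε ε<1 (negF-involutive f) qd pc)))
  where
  K : ℕ
  K = C 0≤ε ε<1
  squares : ∀ K a b → K * (a * a) * (b * b) ≡ K * (a * (a * 1)) * (b * (b * 1))
  squares = solve-∀ⁿ
  squares-swap : ∀ K c d → K * (d * d) * (c * c) ≡ K * (c * (c * 1)) * (d * (d * 1))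
  squares-swap = solve-∀ⁿ
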